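{- There exist $\varepsilon>0$ and $N_0$ such that the following holds for all $n\ge N_0$. If $G$ is an $n$-vertex triangle-free graph with $\delta_{C_5}(G)\ge(10-\varepsilon)(n/5)^4$, then $G$ is $C_5$-colorable.
   Context: For graphs $Q,G$, an injective homomorphism from $Q$ to $G$ is an injective map $\phi\colon V(Q)\to V(G)$ mapping edges to edges. For $v\in V(G)$, the $C_5$-degree $d_{C_5,G}(v)$ is the number of injective homomorphisms $\phi$ from the 5-cycle $C_5$ to $G$ with $v\in\phi(V(C_5))$, and $\delta_{C_5}(G)$ is the minimum $C_5$-degree over all vertices. $G$ is $C_5$-colorable if there is a homomorphism (edge-preserving map, not necessarily injective) from $G$ to $C_5$. -}

module Defs where

open import Data.Nat using (ℕ; _+_; _%_)
open import Data.Fin using (Fin; toℕ)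
open import Data.Fin.Properties using (_≟_)
open import Data.Bool using (Bool; true; false; _∧_; _∨_; not)
open import Data.List using (List; []; _∷_; length; filter; concatMap; map)
open import Data.Fin.Base using () 
open import Data.List using (allFin)
open import Data.Product using (_×_; _,_; ∃)
open import Data.Empty using (⊥)
open import Relation.Nullary.Decidable using (⌊_⌋)
open import Relation.Binary.PropositionalEquality using (_≡_; _≢_)
open import Data.Rational using (ℚ; _/_)
open import Data.Integer using (+_)

record Graph (n : ℕ) : Set where
  field
    adj       : Fin n → Fin n → Bool
    symmetric : ∀ i j → adj i j ≡ adj j i
    loopless  : ∀ i → adj i i ≡ false
open Graph public

-- Triangle-free: no three mutually adjacent vertices (distinctness is
-- automatic since the graph is loopless).
TriangleFree : ∀ {n} → Graph n → Set
TriangleFree G = ∀ a b c → adj G a b ≡ true → adj G b c ≡ true → adj G a c ≡ true → ⊥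

C5adj : Fin 5 → Fin 5 → Set
C5adj x y = ((toℕ x + 1) % 5 ≡ toℕ y) Data.Sum.⊎ ((toℕ y + 1) % 5 ≡ toℕ x)
  where import Data.Sum

C5Colorable : ∀ {n} → Graph n → Set
C5Colorable {n} G = ∃ λ (f : Fin n → Fin 5) → ∀ i j → adj G i j ≡ true → C5adj (f i) (f j)

eqb : ∀ {n} → Fin n → Fin n → Bool
eqb i j = ⌊ i ≟ j ⌋

-- All maps Fin 5 → Fin n, represented as 5-tuples (φ0,…,φ4).
Tuple5 : ℕ → Set
Tuple5 n = Fin n × Fin n × Fin n × Fin n × Fin n

allTuples5 : (n : ℕ) → List (Tuple5 n)
allTuples5 n =
  concatMap (λ a → concatMap (λ b → concatMap (λ c → concatMap (λ d →
    map (λ e → (a , b , c , d , e)) (allFin n)) (allFin n)) (allFin n)) (allFin n)) (allFin n)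

isInjHomC5Through : ∀ {n} → Graph n → Fin n → Tuple5 n → Bool
isInjHomC5Through G v (a , b , c , d , e) =
  (adj G a b ∧ adj G b c ∧ adj G c d ∧ adj G d e ∧ adj G e a)
  ∧ not (eqb a b ∨ eqb a c ∨ eqb a d ∨ eqb a e ∨ eqb b c ∨ eqb b d ∨ eqb b e
         ∨ eqb c d ∨ eqb c e ∨ eqb d e)
  ∧ (eqb v a ∨ eqb v b ∨ eqb v c ∨ eqb v d ∨ eqb v e)

C5deg : ∀ {n} → Graph n → Fin n → ℕ
C5deg {n} G v = length (filter (λ φ → isInjHomC5Through G v φ Data.Bool.≟ true) (allTuples5 n))
  where import Data.Bool

ℕ→ℚ : ℕ → ℚ
ℕ→ℚ k = (+ k) / 1

{-# OPTIONS --safe #-}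
-- In a triangle-free graph every closed 5-walk is a pentagon, so the C₅-degree of v is at most five
-- times the number of closed 5-walks from v. A flag-algebra certificate, written as a sum of squares
-- over ordered 5-tuples of vertices, bounds the number of closed 5-walks by 2n⁵/625 minus a positive
-- multiple of the sum of (5 deg b − 2n)² over paths a–b–c. Hence some pentagon has all five degrees
-- close to 2n/5, so that almost every vertex is adjacent to exactly two of its vertices: this is a
-- colouring of all but n/T vertices by the vertices of C₅. The C₅-degree condition and AM–GM force
-- every colour class to have nearly n/5 vertices and neighbouring classes to be almost completely joined.
-- Then every vertex r, coloured or not, sees more than half of classes j − 1 and j + 1 for some j. Giving r
-- the colour j is a homomorphism to C₅, since adjacent vertices have no common neighbours.
module Submission where

open import Defs
open import Data.Nat using (ℕ; _≥_; _^_)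
open import Data.Fin using (Fin)
open import Data.Product using (Σ; _×_; _,_; ∃; proj₁; proj₂)
open import Data.Integer using (+_)

open import Algebra.Bundles using (Semiring)
open import Data.Bool.Base using (Bool; true; false; _∧_; _∨_; not) renaming (T to IsTrue)
import Data.Bool.Properties as BoolP
open import Data.Empty using (⊥-elim)
open import Data.Fin.Base using (zero; suc)
open import Data.Fin.Patterns using (0F; 1F; 2F; 3F; 4F)
open import Data.Fin.Properties using (all?; any?; _≟_)
open import Data.Integer.Base as Int using (ℤ; -[1+_]; 0ℤ)
import Data.Integer.Properties as ℤP
import Data.Integer.Tactic.RingSolver as ℤSolver
open import Data.List.Base using (List; []; _∷_; _++_; length; filter; concatMap; map; tabulate)
open import Data.List.Properties using (filter-++; length-++)
open import Data.Maybe.Base using (Maybe; just; nothing)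
open import Data.Nat.Base as Nat using (zero; suc; z≤n; s≤s)
import Data.Nat.Properties as ℕP
open import Data.Nat.Tactic.RingSolver using (solve-∀)
open import Data.Sum using (_⊎_; inj₁; inj₂)
open import Function.Base using (_∘_)
open import Level using (Level)
open import Relation.Binary.PropositionalEquality
open import Relation.Nullary using (Dec; yes; no; ¬?)
open import Relation.Nullary.Decidable using (from-yes; _×-dec_; _⊎-dec_; _→-dec_)

-- The bound 2n⁵/625 is attained by the balanced blow-up of C₅, where every form of the certificate
-- sums to zero, so a graph close to the bound makes each square small. One square is exploited: a
-- closed 5-walk has a path centred at each of its vertices, so averaging over closed walks turns
-- small (5 deg b - 2n)² into one pentagon with five good degrees. Tuples with repeated vertices are
-- counted throughout, so there are no lower-order terms and N₀ = 1 works.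
--
-- The obstacle is the uncoloured vertices, whose neighbourhoods are a priori unrestricted.
-- Triangle-freeness controls them: a neighbour of r in class k occupies almost all of classes k ±
-- 1, so r sees little of these. This confines r essentially to two classes at distance two in C₅.
-- Closed walks from r then run round the cycle in two directions, and seeing at most half of one of
-- the two classes would halve their number, far more than all accumulated errors. The final colour
-- follows this majority rule even at vertices coloured before.

module Certificate where
  -- A kernel sees only the ten adjacencies among five labelled vertices, so an inequality between
  -- kernels is a finite check over 2¹⁰ patterns.
  Kernel : Set
  Kernel = (ab ac ad ae bc bd be cd ce de : Bool) → ℤ

  infixl 6 _⊞_
  _⊞_ : Kernel → Kernel → Kernel
  (g ⊞ h) ab ac ad ae bc bd be cd ce de =
    g ab ac ad ae bc bd be cd ce de Int.+ h ab ac ad ae bc bd be cd ce de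

  swapab swapbc swapcd swapde : Kernel → Kernel
  swapab g ab ac ad ae bc bd be cd ce de = g ab bc bd be ac ad ae cd ce de
  swapbc g ab ac ad ae bc bd be cd ce de = g ac ab ad ae bc cd ce bd be de
  swapcd g ab ac ad ae bc bd be cd ce de = g ab ad ac ae bd bc be cd de ce
  swapde g ab ac ad ae bc bd be cd ce de = g ab ac ae ad bc be bd ce cd de

  -- The sum over all 120 permutations of a, b, c, d, e, through coset representatives of Sₖ in Sₖ₊₁.
  symmetrise : Kernel → Kernel
  symmetrise g = g₅
    where
    g₂ = g ⊞ swapab g
    g₃ = g₂ ⊞ swapbc g₂ ⊞ swapab (swapbc g₂)
    g₄ = g₃ ⊞ swapcd g₃ ⊞ swapbc (swapcd g₃) ⊞ swapab (swapbc (swapcd g₃))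
    g₅ = g₄ ⊞ swapde g₄ ⊞ swapcd (swapde g₄) ⊞ swapbc (swapcd (swapde g₄))
           ⊞ swapab (swapbc (swapcd (swapde g₄)))

  -- Represents the square, weighted by weight, of the sum of form over all vertices d, for each triple
  -- (a, b, c) of the given type.
  record Square : Set where
    constructor square
    field
      weight : ℕ
      type   : Bool → Bool → Bool → Bool
      form   : Bool → Bool → Bool → ℤ
  open Square

  cond : Bool → ℤ → ℤ
  cond true  z = z
  cond false z = 0ℤ

  squareKernel : Square → Kernel
  squareKernel s ab ac ad ae bc bd be cd ce de =
    cond (type s ab ac bc) (+ weight s Int.* (form s ad bd cd Int.* form s ae be ce))

  ⟦_⟧ : Bool → ℕ
  ⟦ true ⟧  = 1
  ⟦ false ⟧ = 0

  path edge empty : Bool → Bool → Bool → Bool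
  path  ab ac bc = ab ∧ not ac ∧ bc
  edge  ab ac bc = ab ∧ not ac ∧ not bc
  empty ab ac bc = not ab ∧ not ac ∧ not bc

  -- The value of a form at a vertex x according to which of a, b, c are adjacent to x. Combinations that
  -- would create a triangle with the edges of the type get the dummy value 0.
  byTrace : (∅ a b c ac bc ab abc : ℤ) → Bool → Bool → Bool → ℤ
  byTrace ∅ a b c ac bc ab abc false false false = ∅
  byTrace ∅ a b c ac bc ab abc true  false false = a
  byTrace ∅ a b c ac bc ab abc false true  false = b
  byTrace ∅ a b c ac bc ab abc false false true  = c
  byTrace ∅ a b c ac bc ab abc true  false true  = ac
  byTrace ∅ a b c ac bc ab abc false true  true  = bc
  byTrace ∅ a b c ac bc ab abc true  true  false = ab
  byTrace ∅ a b c ac bc ab abc true  true  true  = abc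

  -- Summed over all vertices this gives 5 deg b - 2n, which vanishes when every degree is 2n/5, as
  -- in the balanced blow-up of C₅.
  centre : Bool → Bool → Bool → ℤ
  centre a b c = + 5 Int.* + ⟦ b ⟧ Int.- + 2

  -- A rounded solution of the semidefinite program of the flag algebra method for five-vertex
  -- triangle-free graphs; all forms sum to zero over the vertices of a balanced blow-up of C₅.
  otherSquares : List Square
  otherSquares =
      square 94    path  (byTrace (Int.- + 10) (Int.- + 4) (+ 3) (Int.- + 4) (+ 2) 0ℤ 0ℤ 0ℤ)
    ∷ square 506   path  (byTrace (+ 4) (+ 1) 0ℤ (+ 1) (Int.- + 2) 0ℤ 0ℤ 0ℤ)
    ∷ square 21996 path  (byTrace 0ℤ (+ 1) 0ℤ (Int.- + 1) 0ℤ 0ℤ 0ℤ 0ℤ)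
    ∷ square 27000 edge  (byTrace 0ℤ 0ℤ 0ℤ 0ℤ (+ 1) (Int.- + 1) 0ℤ 0ℤ)
    ∷ square 3000  edge  (byTrace 0ℤ (+ 1) (+ 1) (Int.- + 2) (Int.- + 1) (Int.- + 1) 0ℤ 0ℤ)
    ∷ square 47    edge  (byTrace (Int.- + 4) (+ 3) (+ 3) 0ℤ (Int.- + 1) (Int.- + 1) 0ℤ 0ℤ)
    ∷ square 19    edge  (byTrace (+ 2) 0ℤ 0ℤ 0ℤ (Int.- + 1) (Int.- + 1) 0ℤ 0ℤ)
    ∷ square 185   edge  (byTrace (+ 6) (Int.- + 3) (Int.- + 3) (Int.- + 8) 0ℤ 0ℤ 0ℤ 0ℤ)
    ∷ square 8     empty (byTrace (Int.- + 6) (+ 17) (+ 17) (+ 17) (Int.- + 14) (Int.- + 14) (Int.- + 14) (+ 9))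
    ∷ []

  pentagonKernel : Kernel
  pentagonKernel ab ac ad ae bc bd be cd ce de = + ⟦ ab ∧ bc ∧ cd ∧ de ∧ ae ⟧

  sumOfSquares : List Square → Kernel
  sumOfSquares []       _ _ _ _ _ _ _ _ _ _ = 0ℤ
  sumOfSquares (s ∷ ss) = squareKernel s ⊞ sumOfSquares ss

  -- Kept apart from `otherSquares`, which enter only through the sign of their total: this square
  -- survives into the final inequality and measures the distance from regularity.
  centreSquare : Square
  centreSquare = square 162 path centre

  defect : Kernel
  defect ab ac ad ae bc bd be cd ce de =
    -- 288/90000 = 2/625 is the density of closed 5-walks in the balanced blow-up of C₅: ten cyclic
    -- arrangements of the classes, each of density (1/5)⁵.
    + 288 Int.+ Int.- (+ 90000 Int.* pentagonKernel ab ac ad ae bc bd be cd ce de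
      Int.+ sumOfSquares (centreSquare ∷ otherSquares) ab ac ad ae bc bd be cd ce de)

  hasTriangle : (ab ac ad ae bc bd be cd ce de : Bool) → Bool
  hasTriangle ab ac ad ae bc bd be cd ce de =
    ab ∧ ac ∧ bc ∨ ab ∧ ad ∧ bd ∨ ab ∧ ae ∧ be ∨ ac ∧ ad ∧ cd ∨ ac ∧ ae ∧ ce ∨
    ad ∧ ae ∧ de ∨ bc ∧ bd ∧ cd ∨ bc ∧ be ∧ ce ∨ bd ∧ be ∧ de ∨ cd ∧ ce ∧ de

  BoolFun : ℕ → Set
  BoolFun zero    = Bool
  BoolFun (suc k) = Bool → BoolFun k

  every : ∀ k → BoolFun k → Bool
  every zero    b = b
  every (suc k) f = every k (f false) ∧ every k (f true)

  Every : ∀ k → BoolFun k → Set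
  Every zero    b = b ≡ true
  Every (suc k) f = ∀ b → Every k (f b)

  -- Proof by reflection: `every` is evaluated by computation, which turns 2ᵏ cases into one `refl`.
  every-sound : ∀ k (f : BoolFun k) → every k f ≡ true → Every k f
  every-sound zero    b eq = eq
  every-sound (suc k) f eq b with every k (f false) in f₀ | every k (f true) in f₁
  every-sound (suc k) f eq true  | true | true = every-sound k (f true) f₁
  every-sound (suc k) f eq false | true | true = every-sound k (f false) f₀

  isNonNeg : ℤ → Bool
  isNonNeg (+ _)    = true
  isNonNeg -[1+ _ ] = false

  -- For a single ordering the defect can be negative, for instance on a pentagon listed in cyclic
  -- order; only the sum over all orderings of a pattern has a sign.
  defect-nonNeg : ∀ ab ac ad ae bc bd be cd ce de →
    hasTriangle ab ac ad ae bc bd be cd ce de ∨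
    isNonNeg (symmetrise defect ab ac ad ae bc bd be cd ce de) ≡ true
  defect-nonNeg = every-sound 10 (λ ab ac ad ae bc bd be cd ce de →
    hasTriangle ab ac ad ae bc bd be cd ce de ∨
    isNonNeg (symmetrise defect ab ac ad ae bc bd be cd ce de)) refl

-- Sums over tuples of vertices, in any semiring

module FiveFold {c ℓ : Level} (R : Semiring c ℓ) where
  open Semiring R using (Carrier; _≈_; _+_; _*_; 0#) renaming (refl to ≈-refl; sym to ≈-sym; trans to ≈-trans)
  open import Algebra.Properties.Semiring.Sum R

  opaque
    ∑ : ∀ {n} → (Fin n → Carrier) → Carrier
    ∑ = sum

    ∑-empty : (f : Fin 0 → Carrier) → ∑ f ≈ 0#
    ∑-empty f = ≈-refl

    ∑-suc : ∀ {n} (f : Fin (suc n) → Carrier) → ∑ f ≈ f zero + ∑ (f ∘ suc)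
    ∑-suc f = ≈-refl

    ∑-cong : ∀ {n} {f g : Fin n → Carrier} → (∀ i → f i ≈ g i) → ∑ f ≈ ∑ g
    ∑-cong = sum-cong-≋

    ∑-+ : ∀ {n} (f g : Fin n → Carrier) → ∑ (λ i → f i + g i) ≈ ∑ f + ∑ g
    ∑-+ = ∑-distrib-+

    ∑-swap : ∀ {n} (f : Fin n → Fin n → Carrier) → ∑ (λ i → ∑ λ j → f i j) ≈ ∑ λ j → ∑ λ i → f i j
    ∑-swap = ∑-comm

    ∑-zero : ∀ {n} → ∑ {n} (λ _ → 0#) ≈ 0#
    ∑-zero {n} = sum-replicate-zero n

    ∑-*ˡ : ∀ {n} x (f : Fin n → Carrier) → ∑ (λ i → x * f i) ≈ x * ∑ f
    ∑-*ˡ x f = ≈-sym (*-distribˡ-sum x f)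

    ∑-*ʳ : ∀ {n} x (f : Fin n → Carrier) → ∑ (λ i → f i * x) ≈ ∑ f * x
    ∑-*ʳ x f = ≈-sym (*-distribʳ-sum x f)

  module _ {n : ℕ} where
    Summand₅ : Set c
    Summand₅ = (a b c d e : Fin n) → Carrier

    ∑₅ : Summand₅ → Carrier
    ∑₅ f = ∑ λ a → ∑ λ b → ∑ λ c → ∑ λ d → ∑ λ e → f a b c d e

    ∑₅-cong : {f g : Summand₅} → (∀ a b c d e → f a b c d e ≈ g a b c d e) → ∑₅ f ≈ ∑₅ g
    ∑₅-cong f≈g = ∑-cong λ a → ∑-cong λ b → ∑-cong λ c → ∑-cong λ d → ∑-cong λ e → f≈g a b c d e

    ∑₅-+ : (f g : Summand₅) → ∑₅ (λ a b c d e → f a b c d e + g a b c d e) ≈ ∑₅ f + ∑₅ g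
    ∑₅-+ f g =
      ≈-trans (∑-cong λ a →
      ≈-trans (∑-cong λ b →
      ≈-trans (∑-cong λ c →
      ≈-trans (∑-cong λ d →
        ∑-+ _ _) (∑-+ _ _)) (∑-+ _ _)) (∑-+ _ _)) (∑-+ _ _)

    ∑₅-*ˡ : ∀ x (f : Summand₅) → ∑₅ (λ a b c d e → x * f a b c d e) ≈ x * ∑₅ f
    ∑₅-*ˡ x f =
      ≈-trans (∑-cong λ a →
      ≈-trans (∑-cong λ b →
      ≈-trans (∑-cong λ c →
      ≈-trans (∑-cong λ d →
        ∑-*ˡ x _) (∑-*ˡ x _)) (∑-*ˡ x _)) (∑-*ˡ x _)) (∑-*ˡ x _)

    module _ (f : Summand₅) where
      ∑₅-swapab : ∑₅ f ≈ ∑₅ λ a b c d e → f b a c d e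
      ∑₅-swapab = ∑-swap λ a b → ∑ λ c → ∑ λ d → ∑ λ e → f a b c d e

      ∑₅-swapbc : ∑₅ f ≈ ∑₅ λ a b c d e → f a c b d e
      ∑₅-swapbc = ∑-cong λ a → ∑-swap λ b c → ∑ λ d → ∑ λ e → f a b c d e

      ∑₅-swapcd : ∑₅ f ≈ ∑₅ λ a b c d e → f a b d c e
      ∑₅-swapcd = ∑-cong λ a → ∑-cong λ b → ∑-swap λ c d → ∑ λ e → f a b c d e

      ∑₅-swapde : ∑₅ f ≈ ∑₅ λ a b c d e → f a b c e d
      ∑₅-swapde = ∑-cong λ a → ∑-cong λ b → ∑-cong λ c → ∑-swap λ d e → f a b c d e

    ∑₅-rotate : (f : Summand₅) → ∑₅ (λ a b c d e → f b c d e a) ≈ ∑₅ f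
    ∑₅-rotate f =
      ≈-trans (∑₅-swapab λ a b c d e → f b c d e a)
      (≈-trans (∑₅-swapbc λ a b c d e → f a c d e b)
      (≈-trans (∑₅-swapcd λ a b c d e → f a b d e c) (∑₅-swapde λ a b c d e → f a b c e d)))

module ∑ℕ = FiveFold ℕP.+-*-semiring
module ∑ℤ = FiveFold ℤP.+-*-semiring

module NatSums where
  open import Data.Nat.Base
  open ℕP
  open ∑ℕ

  ∑-mono-≤ : ∀ {n} {f g : Fin n → ℕ} → (∀ i → f i ≤ g i) → ∑ f ≤ ∑ g
  ∑-mono-≤ {zero}  {f} {g} f≤g = ≤-reflexive (trans (∑-empty f) (sym (∑-empty g)))
  ∑-mono-≤ {suc n} {f} {g} f≤g = begin
    ∑ f                      ≡⟨ ∑-suc f ⟩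
    f zero + ∑ (f ∘ suc)     ≤⟨ +-mono-≤ (f≤g zero) (∑-mono-≤ (f≤g ∘ suc)) ⟩
    g zero + ∑ (g ∘ suc)     ≡⟨ ∑-suc g ⟨
    ∑ g                      ∎
    where open ≤-Reasoning

  ∑-const : ∀ n (x : ℕ) → ∑ {n} (λ _ → x) ≡ n * x
  ∑-const zero    x = ∑-empty _
  ∑-const (suc n) x = trans (∑-suc {n} _) (cong (_+_ x) (∑-const n x))

  ∑₅-mono-≤ : ∀ {n} {f g : Summand₅ {n}} → (∀ a b c d e → f a b c d e ≤ g a b c d e) → ∑₅ f ≤ ∑₅ g
  ∑₅-mono-≤ f≤g = ∑-mono-≤ λ a → ∑-mono-≤ λ b → ∑-mono-≤ λ c → ∑-mono-≤ λ d →
                  ∑-mono-≤ λ e → f≤g a b c d e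

  ∑-<⇒∃< : ∀ {n} {f g : Fin n → ℕ} → ∑ f < ∑ g → ∃ λ i → f i < g i
  ∑-<⇒∃< {zero}  {f} {g} ∑f<∑g = ⊥-elim (<-irrefl (trans (∑-empty f) (sym (∑-empty g))) ∑f<∑g)
  ∑-<⇒∃< {suc n} {f} {g} ∑f<∑g with f zero <? g zero | ∑ (f ∘ suc) <? ∑ (g ∘ suc)
  ... | yes f₀<g₀ | _     = zero , f₀<g₀
  ... | no  f₀≮g₀ | yes t with ∑-<⇒∃< {f = f ∘ suc} {g ∘ suc} t
  ...   | i , fᵢ<gᵢ = suc i , fᵢ<gᵢ
  ∑-<⇒∃< {suc n} {f} {g} ∑f<∑g | no f₀≮g₀ | no t =
    ⊥-elim (<⇒≱ ∑f<∑g (subst₂ _≤_ (sym (∑-suc g)) (sym (∑-suc f)) (+-mono-≤ (≮⇒≥ f₀≮g₀) (≮⇒≥ t))))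

module IntSums where
  open import Data.Integer.Base hiding (suc)
  open ℤP
  open ∑ℤ

  ∑-mono-≤ : ∀ {n} {f g : Fin n → ℤ} → (∀ i → f i ≤ g i) → ∑ f ≤ ∑ g
  ∑-mono-≤ {zero}  {f} {g} f≤g = ≤-reflexive (trans (∑-empty f) (sym (∑-empty g)))
  ∑-mono-≤ {suc n} {f} {g} f≤g = begin
    ∑ f                      ≡⟨ ∑-suc f ⟩
    f zero + ∑ (f ∘ suc)     ≤⟨ +-mono-≤ (f≤g zero) (∑-mono-≤ (f≤g ∘ suc)) ⟩
    g zero + ∑ (g ∘ suc)     ≡⟨ ∑-suc g ⟨
    ∑ g                      ∎
    where open ≤-Reasoning

  ∑-const : ∀ n (x : ℤ) → ∑ {n} (λ _ → x) ≡ + n * x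
  ∑-const zero    x = ∑-empty _
  ∑-const (suc n) x = trans (∑-suc {n} _) (trans (cong (_+_ x) (∑-const n x)) (sym (suc-* (+ n) x)))

  ∑-nonNeg : ∀ {n} {f : Fin n → ℤ} → (∀ i → 0ℤ ≤ f i) → 0ℤ ≤ ∑ f
  ∑-nonNeg {n} {f} 0≤f = subst (_≤ ∑ f) (∑-zero {n}) (∑-mono-≤ 0≤f)

  ∑-pos : ∀ {n} (f : Fin n → ℕ) → ∑ (λ i → + f i) ≡ + ∑ℕ.∑ f
  ∑-pos {zero}  f = trans (∑-empty _) (cong +_ (sym (∑ℕ.∑-empty f)))
  ∑-pos {suc n} f = trans (∑-suc {n} _) (trans (cong (_+_ (+ f zero)) (∑-pos (f ∘ suc))) (cong +_ (sym (∑ℕ.∑-suc f))))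

-- Evaluating the certificate on a graph

module SumOfSquares where
  open Certificate
  open Square
  open import Data.Integer.Base hiding (suc)
  open ℤP
  open ∑ℤ
  open IntSums

  *-square-nonNeg : ∀ (w : ℕ) (z : ℤ) → 0ℤ ≤ + w * (z * z)
  *-square-nonNeg w z = subst (_≤ + w * (z * z)) (*-zeroʳ (+ w)) (*-monoˡ-≤-nonNeg (+ w) (z²≥0 z))
    where
    z²≥0 : ∀ z → 0ℤ ≤ z * z
    z²≥0 (+ zero)    = +≤+ Nat.z≤n
    z²≥0 +[1+ n ]    = +≤+ Nat.z≤n
    z²≥0 -[1+ n ]    = +≤+ Nat.z≤n

  module _ {n} (w : ℕ) (f : Fin n → ℤ) where
    -- Since `d` and `e` range independently over all vertices, the diagonal included, the double
    -- sum is an exact square.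
    ∑∑-product : ∑ (λ d → ∑ λ e → + w * (f d * f e)) ≡ + w * (∑ f * ∑ f)
    ∑∑-product = begin
      ∑ (λ d → ∑ λ e → + w * (f d * f e))
        ≡⟨ ∑-cong (λ d → ∑-*ˡ (+ w) (λ e → f d * f e)) ⟩
      ∑ (λ d → + w * ∑ λ e → f d * f e)
        ≡⟨ ∑-cong (λ d → cong (+ w *_) (∑-*ˡ (f d) f)) ⟩
      ∑ (λ d → + w * (f d * ∑ f))
        ≡⟨ ∑-*ˡ (+ w) (λ d → f d * ∑ f) ⟩
      + w * ∑ (λ d → f d * ∑ f)
        ≡⟨ cong (+ w *_) (∑-*ʳ (∑ f) f) ⟩
      + w * (∑ f * ∑ f) ∎
      where open ≡-Reasoning

    cond-square : ∀ b → ∑ (λ d → ∑ λ e → cond b (+ w * (f d * f e))) ≡ cond b (+ w * (∑ f * ∑ f))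
    cond-square true  = ∑∑-product
    cond-square false = trans (∑-cong {n} λ _ → ∑-zero {n}) (∑-zero {n})

  module _ {n} (G : Graph n) where

    -- The vertices may coincide: equal vertices look like non-adjacent twins to a kernel, so sums over
    -- all tuples carry no error term.
    at : Kernel → Summand₅ {n}
    at g a b c d e = g (adj G a b) (adj G a c) (adj G a d) (adj G a e) (adj G b c)
                       (adj G b d) (adj G b e) (adj G c d) (adj G c e) (adj G d e)

    opaque
      total : Kernel → ℤ
      total g = ∑₅ (at g)

      total-unfold : ∀ g → total g ≡ ∑₅ (at g)
      total-unfold g = refl

    opaque
      unfolding total

      total-⊞ : ∀ g h → total (g ⊞ h) ≡ total g + total h
      total-⊞ g h = ∑₅-+ (at g) (at h)

      total-swapab : ∀ g → total (swapab g) ≡ total g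
      total-swapab g = trans (∑₅-cong swapped) (sym (∑₅-swapab (at g)))
        where
        swapped : ∀ a b c d e → at (swapab g) a b c d e ≡ at g b a c d e
        swapped a b c d e rewrite symmetric G b a = refl

      total-swapbc : ∀ g → total (swapbc g) ≡ total g
      total-swapbc g = trans (∑₅-cong swapped) (sym (∑₅-swapbc (at g)))
        where
        swapped : ∀ a b c d e → at (swapbc g) a b c d e ≡ at g a c b d e
        swapped a b c d e rewrite symmetric G c b = refl

      total-swapcd : ∀ g → total (swapcd g) ≡ total g
      total-swapcd g = trans (∑₅-cong swapped) (sym (∑₅-swapcd (at g)))
        where
        swapped : ∀ a b c d e → at (swapcd g) a b c d e ≡ at g a b d c e
        swapped a b c d e rewrite symmetric G d c = refl

      total-swapde : ∀ g → total (swapde g) ≡ total g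
      total-swapde g = trans (∑₅-cong swapped) (sym (∑₅-swapde (at g)))
        where
        swapped : ∀ a b c d e → at (swapde g) a b c d e ≡ at g a b c e d
        swapped a b c d e rewrite symmetric G e d = refl

    -- Each swap of neighbouring variables preserves the total, by reindexing the sum and symmetry
    -- of `adj`; the coset stages contribute factors 2, 3, 4 and 5.
    total-symmetrise : ∀ g → total (symmetrise g) ≡ + 120 * total g
    total-symmetrise g = trans (e₄ ⊕ f₁ ⊕ f₂ ⊕ f₃ ⊕ f₄) (collect (total g))
      where
      infixl 6 _⊕_
      _⊕_ : ∀ {g h x y} → total g ≡ x → total h ≡ y → total (g ⊞ h) ≡ x + y
      _⊕_ {g} {h} p q = trans (total-⊞ g h) (cong₂ _+_ p q)
      e₂ : total (g ⊞ swapab g) ≡ total g + total g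
      e₂ = refl ⊕ total-swapab g
      g₂ = g ⊞ swapab g
      d₁ = trans (total-swapbc g₂) e₂
      d₂ = trans (total-swapab (swapbc g₂)) d₁
      g₃ = g₂ ⊞ swapbc g₂ ⊞ swapab (swapbc g₂)
      e₃ = e₂ ⊕ d₁ ⊕ d₂
      c₁ = trans (total-swapcd g₃) e₃
      c₂ = trans (total-swapbc (swapcd g₃)) c₁
      c₃ = trans (total-swapab (swapbc (swapcd g₃))) c₂
      g₄ = g₃ ⊞ swapcd g₃ ⊞ swapbc (swapcd g₃) ⊞ swapab (swapbc (swapcd g₃))
      e₄ = e₃ ⊕ c₁ ⊕ c₂ ⊕ c₃
      f₁ = trans (total-swapde g₄) e₄
      f₂ = trans (total-swapcd (swapde g₄)) f₁
      f₃ = trans (total-swapbc (swapcd (swapde g₄))) f₂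
      f₄ = trans (total-swapab (swapbc (swapcd (swapde g₄)))) f₃
      collect : ∀ x → let y = x + x ; z = y + y + y ; w = z + z + z + z in
                w + w + w + w + w ≡ + 120 * x
      collect = ℤSolver.solve-∀

    opaque
      unfolding total

      total-nonNeg : ∀ g → (∀ a b c d e → 0ℤ ≤ at g a b c d e) → 0ℤ ≤ total g
      total-nonNeg g 0≤g = ∑-nonNeg λ a → ∑-nonNeg λ b → ∑-nonNeg λ c → ∑-nonNeg λ d →
                           ∑-nonNeg λ e → 0≤g a b c d e

      total-cong : ∀ {g h} → (∀ ab ac ad ae bc bd be cd ce de →
        g ab ac ad ae bc bd be cd ce de ≡ h ab ac ad ae bc bd be cd ce de) → total g ≡ total h
      total-cong g≡h = ∑₅-cong λ _ _ _ _ _ → g≡h _ _ _ _ _ _ _ _ _ _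

    formSum : Square → Fin n → Fin n → Fin n → ℤ
    formSum s a b c = ∑ λ d → form s (adj G a d) (adj G b d) (adj G c d)

    typed : Square → Fin n → Fin n → Fin n → ℤ → ℤ
    typed s a b c = cond (type s (adj G a b) (adj G a c) (adj G b c))

    squareValue : Square → Fin n → Fin n → Fin n → ℤ
    squareValue s a b c = typed s a b c (+ weight s * (formSum s a b c * formSum s a b c))

    opaque
      unfolding total

      total-square : ∀ s → total (squareKernel s) ≡ ∑ λ a → ∑ λ b → ∑ λ c → squareValue s a b c
      total-square s = ∑-cong λ a → ∑-cong λ b → ∑-cong λ c →
        cond-square (weight s) (λ d → form s (adj G a d) (adj G b d) (adj G c d))
                    (type s (adj G a b) (adj G a c) (adj G b c))

    squareValue-nonNeg : ∀ s a b c → 0ℤ ≤ squareValue s a b c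
    squareValue-nonNeg s a b c with type s (adj G a b) (adj G a c) (adj G b c)
    ... | true  = *-square-nonNeg (weight s) (formSum s a b c)
    ... | false = ≤-refl

    total-sumOfSquares-nonNeg : ∀ ss → 0ℤ ≤ total (sumOfSquares ss)
    total-sumOfSquares-nonNeg [] = total-nonNeg (λ _ _ _ _ _ _ _ _ _ _ → 0ℤ) λ _ _ _ _ _ → ≤-refl
    total-sumOfSquares-nonNeg (s ∷ ss) = subst (0ℤ ≤_) (sym (total-⊞ (squareKernel s) (sumOfSquares ss)))
      (+-mono-≤ (subst (0ℤ ≤_) (sym (total-square s))
                   (∑-nonNeg λ a → ∑-nonNeg λ b → ∑-nonNeg λ c → squareValue-nonNeg s a b c))
                (total-sumOfSquares-nonNeg ss))

    noTriangle : TriangleFree G → ∀ x y z → adj G x y ∧ adj G x z ∧ adj G y z ≡ false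
    noTriangle tf x y z with adj G x y in xy | adj G x z in xz | adj G y z in yz
    ... | true  | true  | true  = ⊥-elim (tf x y z xy yz xz)
    ... | true  | true  | false = refl
    ... | true  | false | _     = refl
    ... | false | _     | _     = refl

    hasTriangle-false : TriangleFree G → ∀ a b c d e →
      hasTriangle (adj G a b) (adj G a c) (adj G a d) (adj G a e) (adj G b c)
                  (adj G b d) (adj G b e) (adj G c d) (adj G c e) (adj G d e) ≡ false
    hasTriangle-false tf a b c d e
      rewrite noTriangle tf a b c | noTriangle tf a b d | noTriangle tf a b e | noTriangle tf a c d | noTriangle tf a c e
            | noTriangle tf a d e | noTriangle tf b c d | noTriangle tf b c e | noTriangle tf b d e | noTriangle tf c d e = refl

    total-defect-nonNeg : TriangleFree G → 0ℤ ≤ total defect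
    total-defect-nonNeg tf = *-cancelˡ-≤-pos 0ℤ (total defect) (+ 120)
      (subst (0ℤ ≤_) (total-symmetrise defect)
        (total-nonNeg (symmetrise defect) λ a b c d e →
          pattern-nonNeg (hasTriangle-false tf a b c d e)
            (defect-nonNeg (adj G a b) (adj G a c) (adj G a d) (adj G a e) (adj G b c)
                           (adj G b d) (adj G b e) (adj G c d) (adj G c e) (adj G d e))))
      where
      pattern-nonNeg : ∀ {t z} → t ≡ false → t ∨ isNonNeg z ≡ true → 0ℤ ≤ z
      pattern-nonNeg {z = + _} refl _ = +≤+ Nat.z≤n

    pentagons : ℤ
    pentagons = total pentagonKernel

    opaque
      unfolding total

      total-scale : ∀ w g → total (λ ab ac ad ae bc bd be cd ce de → w * g ab ac ad ae bc bd be cd ce de) ≡ w * total g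
      total-scale w g = ∑₅-*ˡ w (at g)

      total-const : ∀ z → total (λ _ _ _ _ _ _ _ _ _ _ → z) ≡ + n * (+ n * (+ n * (+ n * (+ n * z))))
      total-const z =
        trans (∑-cong {n} λ a →
        trans (∑-cong {n} λ b →
        trans (∑-cong {n} λ c →
        trans (∑-cong {n} λ d →
          ∑-const n z) (∑-const n _)) (∑-const n _)) (∑-const n _)) (∑-const n _)

    pentagons-bound : TriangleFree G →
      + 90000 * pentagons + (∑ λ a → ∑ λ b → ∑ λ c → squareValue centreSquare a b c)
        ≤ + n * (+ n * (+ n * (+ n * (+ n * + 288))))
    pentagons-bound tf = begin
      + 90000 * pentagons + S
        ≡⟨ cong₂ _+_ (total-scale (+ 90000) pentagonKernel) (total-square centreSquare) ⟨
      total 90000P + total (squareKernel centreSquare)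
        ≤⟨ +-monoʳ-≤ (total 90000P) (i≤i+nonNeg (total-sumOfSquares-nonNeg otherSquares)) ⟩
      total 90000P + (total (squareKernel centreSquare) + total (sumOfSquares otherSquares))
        ≡⟨ cong (_+_ (total 90000P)) (total-⊞ (squareKernel centreSquare) (sumOfSquares otherSquares)) ⟨
      total 90000P + total (sumOfSquares (centreSquare ∷ otherSquares))
        ≡⟨ total-⊞ 90000P (sumOfSquares (centreSquare ∷ otherSquares)) ⟨
      total K
        ≤⟨ i≤i+nonNeg (total-defect-nonNeg tf) ⟩
      total K + total defect
        ≡⟨ total-⊞ K defect ⟨
      total (K ⊞ defect)
        ≡⟨ total-cong (λ ab ac ad ae bc bd be cd ce de → cancel (K ab ac ad ae bc bd be cd ce de)) ⟩
      total (λ _ _ _ _ _ _ _ _ _ _ → + 288)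
        ≡⟨ total-const (+ 288) ⟩
      + n * (+ n * (+ n * (+ n * (+ n * + 288)))) ∎
      where
      open ≤-Reasoning
      S = ∑ λ a → ∑ λ b → ∑ λ c → squareValue centreSquare a b c
      90000P : Kernel
      90000P ab ac ad ae bc bd be cd ce de = + 90000 * pentagonKernel ab ac ad ae bc bd be cd ce de
      K = 90000P ⊞ sumOfSquares (centreSquare ∷ otherSquares)
      i≤i+nonNeg : ∀ {i j} → 0ℤ ≤ j → i ≤ i + j
      i≤i+nonNeg {i} {j} 0≤j = subst (_≤ i + j) (+-identityʳ i) (+-monoʳ-≤ i 0≤j)
      cancel : ∀ k → k + (+ 288 + - k) ≡ + 288
      cancel = ℤSolver.solve-∀

-- Closed 5-walks and their rotations

module Walks where
  open Certificate using (⟦_⟧)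
  open import Data.Nat.Base
  open ℕP
  open ∑ℕ
  open NatSums

  module _ {n} (G : Graph n) where
    isWalk : (a b c d e : Fin n) → Bool
    isWalk a b c d e = adj G a b ∧ adj G b c ∧ adj G c d ∧ adj G d e ∧ adj G e a

    walks : Fin n → ℕ
    walks a = ∑ λ b → ∑ λ c → ∑ λ d → ∑ λ e → ⟦ isWalk a b c d e ⟧

    degree : Fin n → ℕ
    degree v = ∑ λ x → ⟦ adj G v x ⟧

    isWalk-rotate : ∀ a b c d e → isWalk b c d e a ≡ isWalk a b c d e
    isWalk-rotate a b c d e = ∧-rotate (adj G a b) (adj G b c) (adj G c d) (adj G d e) (adj G e a)
      where
      ∧-rotate : ∀ p q r s t → q ∧ r ∧ s ∧ t ∧ p ≡ p ∧ q ∧ r ∧ s ∧ t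
      ∧-rotate p false _     _     _     = sym (BoolP.∧-zeroʳ p)
      ∧-rotate p true  false _     _     = sym (BoolP.∧-zeroʳ p)
      ∧-rotate p true  true  false _     = sym (BoolP.∧-zeroʳ p)
      ∧-rotate p true  true  true  false = sym (BoolP.∧-zeroʳ p)
      ∧-rotate p true  true  true  true  = sym (BoolP.∧-identityʳ p)

    ∑₅-walks-rotate : ∀ (f : Summand₅ {n}) →
      ∑₅ (λ a b c d e → ⟦ isWalk a b c d e ⟧ * f b c d e a) ≡ ∑₅ (λ a b c d e → ⟦ isWalk a b c d e ⟧ * f a b c d e)
    ∑₅-walks-rotate f = trans
      (∑₅-cong λ a b c d e → cong (λ t → ⟦ t ⟧ * f b c d e a) (sym (isWalk-rotate a b c d e)))
      (∑₅-rotate λ a b c d e → ⟦ isWalk a b c d e ⟧ * f a b c d e)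

module Linear where
  open import Data.Nat.Base
  open ℕP

  -- Linear arithmetic over ℕ: S ≤ S′ is a sum of multiples of the hypotheses, and the equation, which
  -- says R − L = S′ − S, is left to the ring solver.
  combine : ∀ {L R S S′} → S ≤ S′ → L + S′ ≡ R + S → L ≤ R
  combine {L} {R} {S} {S′} S≤S′ eq = +-cancelʳ-≤ S′ L R (≤-trans (≤-reflexive eq) (+-monoʳ-≤ R S≤S′))

  sqrt-< : ∀ {x y} → x * x < y * y → x < y
  sqrt-< {x} {y} lt with x <? y
  ... | yes x<y = x<y
  ... | no  x≮y = ⊥-elim (<⇒≱ lt (*-mono-≤ (≮⇒≥ x≮y) (≮⇒≥ x≮y)))

-- A pentagon whose five degrees are close to 2n/5

module NearRegular where
  open Certificate using (⟦_⟧; path; centreSquare; pentagonKernel)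
  open import Data.Nat.Base
  open ℕP
  open ∑ℕ
  open NatSums
  open Walks
  open Linear
  open SumOfSquares

  module _ {n} (G : Graph n) (tf : TriangleFree G) where
    gap : Fin n → ℤ
    gap b = + 5 Int.* + degree G b Int.- + 2 Int.* + n

    deviation : Fin n → ℕ
    deviation b = Int.∣ gap b ∣ * Int.∣ gap b ∣

    isPath : Fin n → Fin n → Fin n → Bool
    isPath a b c = path (adj G a b) (adj G a c) (adj G b c)

    pathDeviation : ℕ
    pathDeviation = ∑ λ a → ∑ λ b → ∑ λ c → ⟦ isPath a b c ⟧ * deviation b

    walkDeviation : ℕ
    walkDeviation = ∑₅ λ a b c d e → ⟦ isWalk G a b c d e ⟧ * deviation b

    formSum-centre : ∀ a b c → formSum G centreSquare a b c ≡ gap b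
    formSum-centre a b c = begin
      ∑ℤ.∑ (λ d → + 5 Int.* + ⟦ adj G b d ⟧ Int.+ Int.- + 2)
        ≡⟨ ∑ℤ.∑-+ _ _ ⟩
      ∑ℤ.∑ (λ d → + 5 Int.* + ⟦ adj G b d ⟧) Int.+ ∑ℤ.∑ {n} (λ _ → Int.- + 2)
        ≡⟨ cong₂ Int._+_ (trans (∑ℤ.∑-*ˡ (+ 5) _) (cong (+ 5 Int.*_) (IntSums.∑-pos _))) (IntSums.∑-const n _) ⟩
      + 5 Int.* + degree G b Int.+ + n Int.* Int.- + 2
        ≡⟨ rearrange (+ degree G b) (+ n) ⟩
      gap b ∎
      where
      open ≡-Reasoning
      rearrange : ∀ d m → + 5 Int.* d Int.+ m Int.* Int.- + 2 ≡ + 5 Int.* d Int.- + 2 Int.* m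
      rearrange = ℤSolver.solve-∀

    abs-square : ∀ z → z Int.* z ≡ + (Int.∣ z ∣ * Int.∣ z ∣)
    abs-square (+ k)          = sym (ℤP.pos-* k k)
    abs-square Int.-[1+ k ]   = refl

    squareValue-centre : ∀ a b c → squareValue G centreSquare a b c ≡ + (162 * (⟦ isPath a b c ⟧ * deviation b))
    squareValue-centre a b c with isPath a b c
    ... | false = refl
    ... | true  = begin
      + 162 Int.* (s Int.* s)         ≡⟨ cong (λ z → + 162 Int.* (z Int.* z)) (formSum-centre a b c) ⟩
      + 162 Int.* (gap b Int.* gap b) ≡⟨ cong (+ 162 Int.*_) (abs-square (gap b)) ⟩
      + 162 Int.* + deviation b       ≡⟨ ℤP.pos-* 162 (deviation b) ⟨
      + (162 * deviation b)           ≡⟨ cong (λ k → + (162 * k)) (sym (+-identityʳ (deviation b))) ⟩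
      + (162 * (1 * deviation b))     ∎
      where
      open ≡-Reasoning
      s = formSum G centreSquare a b c

    ∑₃-pos : (f : Fin n → Fin n → Fin n → ℕ) →
      (∑ℤ.∑ λ a → ∑ℤ.∑ λ b → ∑ℤ.∑ λ c → + f a b c) ≡ + (∑ λ a → ∑ λ b → ∑ λ c → f a b c)
    ∑₃-pos f = trans (∑ℤ.∑-cong λ a → trans (∑ℤ.∑-cong λ b → IntSums.∑-pos _) (IntSums.∑-pos _)) (IntSums.∑-pos _)

    totalWalks : ℕ
    totalWalks = ∑ (walks G)

    pentagons≡totalWalks : pentagons G ≡ + totalWalks
    pentagons≡totalWalks = begin
      pentagons G
        ≡⟨ total-unfold G pentagonKernel ⟩
      ∑ℤ.∑₅ (at G pentagonKernel)
        ≡⟨ ∑ℤ.∑₅-cong (λ a b c d e → cong (λ t → + ⟦ adj G a b ∧ adj G b c ∧ adj G c d ∧ adj G d e ∧ t ⟧) (symmetric G a e)) ⟩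
      ∑ℤ.∑₅ (λ a b c d e → + ⟦ isWalk G a b c d e ⟧)
        ≡⟨ ∑ℤ.∑-cong (λ a → ∑ℤ.∑-cong λ b → ∑₃-pos _) ⟩
      ∑ℤ.∑ (λ a → ∑ℤ.∑ λ b → + ∑ λ c → ∑ λ d → ∑ λ e → ⟦ isWalk G a b c d e ⟧)
        ≡⟨ trans (∑ℤ.∑-cong λ a → IntSums.∑-pos _) (IntSums.∑-pos _) ⟩
      + totalWalks ∎
      where open ≡-Reasoning

    n⁵ : ℕ
    n⁵ = n * (n * (n * (n * n)))

    totalWalks-bound : 5000 * totalWalks + 9 * pathDeviation ≤ 16 * n⁵
    -- 18 is the greatest common divisor of 90000, 162 and 288.
    totalWalks-bound = *-cancelˡ-≤ 18 (begin
      18 * (5000 * totalWalks + 9 * pathDeviation)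
        ≡⟨ *-distribˡ-+ 18 (5000 * totalWalks) (9 * pathDeviation) ⟩
      18 * (5000 * totalWalks) + 18 * (9 * pathDeviation)
        ≡⟨ cong₂ _+_ (*-assoc 18 5000 totalWalks) (*-assoc 18 9 pathDeviation) ⟨
      90000 * totalWalks + 162 * pathDeviation
        ≤⟨ ℤP.drop‿+≤+ bound ⟩
      n * (n * (n * (n * (n * 288))))
        ≡⟨ collect n ⟩
      18 * (16 * n⁵) ∎)
      where
      open ≤-Reasoning
      collect : ∀ n → n * (n * (n * (n * (n * 288)))) ≡ 18 * (16 * (n * (n * (n * (n * n)))))
      collect = solve-∀
      bound : + (90000 * totalWalks + 162 * pathDeviation) Int.≤ + (n * (n * (n * (n * (n * 288)))))
      bound = subst₂ Int._≤_ lhs rhs (pentagons-bound G tf)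
        where
        lhs : + 90000 Int.* pentagons G Int.+ ∑ℤ.∑ (λ a → ∑ℤ.∑ λ b → ∑ℤ.∑ λ c → squareValue G centreSquare a b c)
              ≡ + (90000 * totalWalks + 162 * pathDeviation)
        lhs = cong₂ Int._+_
          (trans (cong (+ 90000 Int.*_) pentagons≡totalWalks) (sym (ℤP.pos-* 90000 totalWalks)))
          (trans (∑ℤ.∑-cong λ a → ∑ℤ.∑-cong λ b → ∑ℤ.∑-cong λ c → squareValue-centre a b c)
          (trans (∑₃-pos _) (cong +_
          (trans (∑-cong λ a → trans (∑-cong λ b → ∑-*ˡ 162 _) (∑-*ˡ 162 _)) (∑-*ˡ 162 _)))))
        rhs : + n Int.* (+ n Int.* (+ n Int.* (+ n Int.* (+ n Int.* + 288)))) ≡ + (n * (n * (n * (n * (n * 288)))))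
        rhs = sym (trans (ℤP.pos-* n _) (cong (+ n Int.*_) (trans (ℤP.pos-* n _) (cong (+ n Int.*_)
          (trans (ℤP.pos-* n _) (cong (+ n Int.*_) (trans (ℤP.pos-* n _) (cong (+ n Int.*_) (ℤP.pos-* n 288)))))))))

    private
      W : Fin n → Fin n → Fin n → Fin n → Fin n → ℕ
      W a b c d e = ⟦ isWalk G a b c d e ⟧

    -- The first three vertices of a closed walk form a path that is induced, there being no
    -- triangles, and the other two vertices take at most n² values.
    walkDeviation-bound : walkDeviation ≤ n * n * pathDeviation
    walkDeviation-bound = begin
      walkDeviation
        ≤⟨ ∑₅-mono-≤ (λ a b c d e → *-monoˡ-≤ (deviation b) (walk⇒path a b c d e)) ⟩
      ∑₅ {n} (λ a b c d e → ⟦ isPath a b c ⟧ * deviation b)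
        ≡⟨ ∑-cong (λ a → ∑-cong λ b → ∑-cong λ c →
             trans (∑-cong {n} λ d → ∑-const n (⟦ isPath a b c ⟧ * deviation b))
                   (trans (∑-const n _) (sym (*-assoc n n _)))) ⟩
      ∑ (λ a → ∑ λ b → ∑ λ c → n * n * (⟦ isPath a b c ⟧ * deviation b))
        ≡⟨ trans (∑-cong λ a → trans (∑-cong λ b → ∑-*ˡ (n * n) _) (∑-*ˡ (n * n) _)) (∑-*ˡ (n * n) _) ⟩
      n * n * pathDeviation ∎
      where
      open ≤-Reasoning
      walk⇒path : ∀ a b c d e → W a b c d e ≤ ⟦ isPath a b c ⟧
      walk⇒path a b c d e with adj G a b in ab | adj G b c in bc | adj G a c in ac
      ... | false | _     | _     = z≤n
      ... | true  | false | _     = z≤n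
      ... | true  | true  | true  = ⊥-elim (tf a b c ab bc ac)
      ... | true  | true  | false with adj G c d ∧ adj G d e ∧ adj G e a
      ...   | true  = s≤s z≤n
      ...   | false = z≤n

    cycleDeviation : (a b c d e : Fin n) → ℕ
    cycleDeviation a b c d e = deviation a + deviation b + deviation c + deviation d + deviation e

    -- Rotating the walk moves any of its five positions to `b`, so all five contribute equally.
    ∑-cycleDeviation : ∑₅ (λ a b c d e → W a b c d e * cycleDeviation a b c d e) ≡ walkDeviation * 5
    ∑-cycleDeviation = begin
      ∑₅ (λ a b c d e → W a b c d e * cycleDeviation a b c d e)
        ≡⟨ ∑₅-cong (λ a b c d e → distrib (W a b c d e) (deviation a) (deviation b) (deviation c) (deviation d) (deviation e)) ⟩
      ∑₅ (λ a b c d e → W a b c d e * deviation a + W a b c d e * deviation b + W a b c d e * deviation c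
                        + W a b c d e * deviation d + W a b c d e * deviation e)
        ≡⟨ trans (∑₅-+ _ _) (cong₂ _+_ (trans (∑₅-+ _ _) (cong₂ _+_ (trans (∑₅-+ _ _) (cong₂ _+_ (∑₅-+ _ _) refl)) refl)) refl) ⟩
      A + X + C + D + E
        ≡⟨ cong₂ _+_ (cong₂ _+_ (cong₂ _+_ (cong₂ _+_ A≡X refl) C≡X) (trans D≡C C≡X)) (trans E≡D (trans D≡C C≡X)) ⟩
      X + X + X + X + X
        ≡⟨ five X ⟩
      X * 5 ∎
      where
      open ≡-Reasoning
      A = ∑₅ λ a b c d e → W a b c d e * deviation a
      X = walkDeviation
      C = ∑₅ λ a b c d e → W a b c d e * deviation c
      D = ∑₅ λ a b c d e → W a b c d e * deviation d
      E = ∑₅ λ a b c d e → W a b c d e * deviation e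
      A≡X : A ≡ X
      A≡X = sym (∑₅-walks-rotate G λ a b c d e → deviation a)
      C≡X : C ≡ X
      C≡X = ∑₅-walks-rotate G λ a b c d e → deviation b
      D≡C : D ≡ C
      D≡C = ∑₅-walks-rotate G λ a b c d e → deviation c
      E≡D : E ≡ D
      E≡D = ∑₅-walks-rotate G λ a b c d e → deviation d
      five : ∀ x → x + x + x + x + x ≡ x * 5
      five = solve-∀
      distrib : ∀ w a b c d e → w * (a + b + c + d + e) ≡ w * a + w * b + w * c + w * d + w * e
      distrib = solve-∀

    -- `manyWalks` is the degree condition for ε = 1/`Q` with denominators cleared: at least (2 -
    -- 1/(5Q))(n/5)⁴ closed walks start at each vertex.
    module _ .{{_ : NonZero n}} (T Q u : ℕ) {{_ : NonZero T}} (Q≡1000T² : Q ≡ T * T * 1000) (u≡625 : u ≡ 625)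
             (manyWalks : ∀ v → 10 * (Q * n ^ 4) ≤ 5 * (u * (Q * walks G v)) + n ^ 4) where
      private
        θ = T * T

      manyWalks-total : 10 * (Q * n⁵) ≤ 5 * (u * (Q * totalWalks)) + n⁵
      manyWalks-total = begin
        10 * (Q * n⁵)
          ≡⟨ l₁ Q n ⟩
        n * (10 * (Q * n ^ 4))
          ≡⟨ ∑-const n _ ⟨
        ∑ {n} (λ _ → 10 * (Q * n ^ 4))
          ≤⟨ ∑-mono-≤ manyWalks ⟩
        ∑ (λ v → 5 * (u * (Q * walks G v)) + n ^ 4)
          ≡⟨ ∑-+ (λ v → 5 * (u * (Q * walks G v))) (λ _ → n ^ 4) ⟩
        ∑ (λ v → 5 * (u * (Q * walks G v))) + ∑ {n} (λ _ → n ^ 4)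
          ≡⟨ cong₂ _+_ (trans (∑-*ˡ 5 (λ v → u * (Q * walks G v))) (cong (5 *_)
               (trans (∑-*ˡ u (λ v → Q * walks G v)) (cong (u *_) (∑-*ˡ Q (walks G)))))) (trans (∑-const n _) (l₂ n)) ⟩
        5 * (u * (Q * totalWalks)) + n⁵ ∎
        where
        open ≤-Reasoning
        l₁ : ∀ q n → 10 * (q * (n * (n * (n * (n * n))))) ≡ n * (10 * (q * (n * (n * (n * (n * 1))))))
        l₁ = solve-∀
        l₂ : ∀ n → n * (n * (n * (n * (n * 1)))) ≡ n * (n * (n * (n * n)))
        l₂ = solve-∀

      -- The lower and upper bounds for `totalWalks` have the same leading term. Five `Q` times the
      -- one plus eight times the other cancels it, and only the error n⁵ of the hypothesis remains
      -- to pay for the deviation.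
      pathDeviation-bound : 45 * (Q * pathDeviation) ≤ 8 * n⁵
      pathDeviation-bound = combine
        (+-mono-≤ (*-monoʳ-≤ (5 * Q) totalWalks-bound′) (*-monoʳ-≤ 8 manyWalks-total))
        (identity u Q totalWalks pathDeviation n⁵)
        where
        5000≡8u : 5000 ≡ 8 * u
        5000≡8u = cong (8 *_) (sym u≡625)
        totalWalks-bound′ : 8 * (u * totalWalks) + 9 * pathDeviation ≤ 16 * n⁵
        totalWalks-bound′ = subst (λ k → k + 9 * pathDeviation ≤ 16 * n⁵)
          (trans (cong (_* totalWalks) 5000≡8u) (*-assoc 8 u totalWalks)) totalWalks-bound
        identity : ∀ u q c p m →
          45 * (q * p) + (5 * q * (16 * m) + 8 * (5 * (u * (q * c)) + m)) ≡
          8 * m + (5 * q * (8 * (u * c) + 9 * p) + 8 * (10 * (q * m)))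
        identity = solve-∀

      instance
        θ≢0 : NonZero θ
        θ≢0 = m*n≢0 T T
        Q≢0 : NonZero Q
        Q≢0 = subst NonZero (sym Q≡1000T²) (m*n≢0 θ 1000)
        n²≢0 : NonZero (n * n)
        n²≢0 = m*n≢0 n n
        n³≢0 : NonZero (n * (n * n))
        n³≢0 = m*n≢0 n (n * n)
        n⁴≢0 : NonZero (n * (n * (n * n)))
        n⁴≢0 = m*n≢0 n (n * (n * n))
        n⁵≢0 : NonZero n⁵
        n⁵≢0 = m*n≢0 n (n * (n * (n * n)))

      totalWalks-lower : 9 * n⁵ ≤ 5 * (u * totalWalks)
      totalWalks-lower = *-cancelˡ-≤ Q (combine
        (+-mono-≤ manyWalks-total (m≤n*m n⁵ Q))
        (identity u Q totalWalks n⁵))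
        where
        identity : ∀ u q c m → q * (9 * m) + (5 * (u * (q * c)) + m + q * m) ≡ q * (5 * (u * c)) + (10 * (q * m) + m)
        identity = solve-∀

      deviation<walks : θ * (walkDeviation * 5) < n * n * totalWalks
      deviation<walks with θ * (walkDeviation * 5) <? n * n * totalWalks
      ... | yes lt = lt
      -- Otherwise `totalWalks` is so small compared with the deviation that 16200 n⁵ ≤ 5000 n⁵. The
      -- factor 1800 satisfies 1800 · 25 = 45 · 1000, which matches `pathDeviation-bound` with `Q` =
      -- 1000 `T`².
      ... | no ≮   = ⊥-elim (<⇒≱ (*-monoˡ-< n⁵ 5000<16200) (begin
        16200 * n⁵                              ≡⟨ *-assoc 1800 9 n⁵ ⟩
        1800 * (9 * n⁵)                         ≤⟨ *-monoʳ-≤ 1800 (*-cancelˡ-≤ (n * n) n²-bound) ⟩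
        1800 * (25 * u * (θ * pathDeviation))   ≡⟨ regroup 1800 25 u 45 1000 θ pathDeviation refl ⟩
        u * (45 * (θ * 1000 * pathDeviation))   ≡⟨ cong (λ q → u * (45 * (q * pathDeviation))) Q≡1000T² ⟨
        u * (45 * (Q * pathDeviation))          ≤⟨ *-monoʳ-≤ u pathDeviation-bound ⟩
        u * (8 * n⁵)                            ≡⟨ *-assoc u 8 n⁵ ⟨
        u * 8 * n⁵                              ≡⟨ cong (λ k → k * 8 * n⁵) u≡625 ⟩
        5000 * n⁵                               ∎))
        where
        open ≤-Reasoning
        5000<16200 : 5000 < 16200
        5000<16200 = ≤ᵇ⇒≤ 5001 16200 _
        regroup : ∀ a b u c d t p → a * b ≡ c * d → a * (b * u * (t * p)) ≡ u * (c * (t * d * p))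
        regroup a b u c d t p ab≡cd = trans (l a b u t p) (trans (cong (_* (u * (t * p))) ab≡cd) (r c d u t p))
          where
          l : ∀ a b u t p → a * (b * u * (t * p)) ≡ a * b * (u * (t * p))
          l = solve-∀
          r : ∀ c d u t p → c * d * (u * (t * p)) ≡ u * (c * (t * d * p))
          r = solve-∀
        n²-bound : n * n * (9 * n⁵) ≤ n * n * (25 * u * (θ * pathDeviation))
        n²-bound = begin
          n * n * (9 * n⁵)                    ≤⟨ *-monoʳ-≤ (n * n) totalWalks-lower ⟩
          n * n * (5 * (u * totalWalks))      ≡⟨ swap (n * n) u totalWalks ⟩
          5 * u * (n * n * totalWalks)      ≤⟨ *-monoʳ-≤ (5 * u) (≮⇒≥ ≮) ⟩
          5 * u * (θ * (walkDeviation * 5)) ≤⟨ *-monoʳ-≤ (5 * u) (*-monoʳ-≤ θ (*-monoˡ-≤ 5 walkDeviation-bound)) ⟩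
          5 * u * (θ * (n * n * pathDeviation * 5)) ≡⟨ shuffle u θ (n * n) pathDeviation ⟩
          n * n * (25 * u * (θ * pathDeviation)) ∎
          where
          swap : ∀ x y z → x * (5 * (y * z)) ≡ 5 * y * (x * z)
          swap = solve-∀
          shuffle : ∀ u t m p → 5 * u * (t * (m * p * 5)) ≡ m * (25 * u * (t * p))
          shuffle = solve-∀

      private
        extract : ∀ {x y} b → θ * (⟦ b ⟧ * x) < y * ⟦ b ⟧ → b ≡ true × θ * x < y
        extract {x} {y} true lt = refl , subst₂ _<_ (cong (θ *_) (*-identityˡ x)) (*-identityʳ y) lt
        extract {x} {y} false lt = ⊥-elim (n≮0 (subst (θ * (0 * x) <_) (*-zeroʳ y) lt))
        ∑<∑ : ∑₅ (λ a b c d e → θ * (W a b c d e * cycleDeviation a b c d e)) < ∑₅ (λ a b c d e → n * n * W a b c d e)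
        ∑<∑ = subst₂ _<_ (sym (trans (∑₅-*ˡ θ _) (cong (θ *_) ∑-cycleDeviation))) (sym (∑₅-*ˡ (n * n) _)) deviation<walks

      -- By `deviation<walks` the average of `cycleDeviation` over closed walks is below (n/T)², so
      -- some walk lies below it; the five vertices are found one summation at a time.
      nearRegularPentagon : ∃ λ a → ∃ λ b → ∃ λ c → ∃ λ d → ∃ λ e →
        isWalk G a b c d e ≡ true × θ * cycleDeviation a b c d e < n * n
      nearRegularPentagon =
        let a , lt-a = ∑-<⇒∃< ∑<∑
            b , lt-b = ∑-<⇒∃< lt-a
            c , lt-c = ∑-<⇒∃< lt-b
            d , lt-d = ∑-<⇒∃< lt-c
            e , lt-e = ∑-<⇒∃< lt-d
        in a , b , c , d , e , extract (isWalk G a b c d e) lt-e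

      degree-lower : ∀ v {rest} → θ * (deviation v + rest) < n * n → 2 * T * n ≤ 5 * T * degree G v + n
      degree-lower v {rest} lt = begin
        2 * T * n                              ≡⟨ comm T n ⟩
        T * (2 * n)                            ≤⟨ *-monoʳ-≤ T gap-lower ⟩
        T * (5 * degree G v + Int.∣ gap v ∣)   ≡⟨ expand T (degree G v) Int.∣ gap v ∣ ⟩
        5 * T * degree G v + T * Int.∣ gap v ∣ ≤⟨ +-monoʳ-≤ (5 * T * degree G v) (<⇒≤ (sqrt-< T∣gap∣<n)) ⟩
        5 * T * degree G v + n                 ∎
        where
        open ≤-Reasoning
        comm : ∀ t n → 2 * t * n ≡ t * (2 * n)
        comm = solve-∀
        expand : ∀ t d g → t * (5 * d + g) ≡ 5 * t * d + t * g
        expand = solve-∀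
        regroup : ∀ t g → t * g * (t * g) ≡ t * t * (g * g)
        regroup = solve-∀
        T∣gap∣<n : T * Int.∣ gap v ∣ * (T * Int.∣ gap v ∣) < n * n
        T∣gap∣<n = ≤-<-trans (≤-trans (≤-reflexive (regroup T Int.∣ gap v ∣)) (*-monoʳ-≤ θ (m≤m+n (deviation v) rest))) lt
        gap-lower : 2 * n ≤ 5 * degree G v + Int.∣ gap v ∣
        gap-lower = begin
          2 * n ≡⟨ cong Int.∣_∣ (trans (ℤP.pos-* 2 n) (recover (+ 5 Int.* + degree G v) (+ 2 Int.* + n))) ⟩
          Int.∣ + 5 Int.* + degree G v Int.- gap v ∣ ≤⟨ ℤP.∣i-j∣≤∣i∣+∣j∣ (+ 5 Int.* + degree G v) (gap v) ⟩
          Int.∣ + 5 Int.* + degree G v ∣ + Int.∣ gap v ∣ ≡⟨ cong (_+ Int.∣ gap v ∣) (ℤP.abs-* (+ 5) (+ degree G v)) ⟩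
          5 * degree G v + Int.∣ gap v ∣ ∎
          where
          recover : ∀ x y → y ≡ x Int.- (x Int.- y)
          recover = ℤSolver.solve-∀

-- Numerical estimates for class sizes and neighbourhoods

module Estimates where
  open import Data.Nat.Base
  open ℕP
  open Linear

  4*a*b≤[a+b]² : ∀ a b → 4 * (a * b) ≤ (a + b) * (a + b)
  4*a*b≤[a+b]² a b with ≤-total a b
  ... | inj₁ a≤b with k , refl ← m≤n⇒∃[o]m+o≡n a≤b = subst (4 * (a * (a + k)) ≤_) (identity a k) (m≤m+n _ (k * k))
    where
    identity : ∀ a k → 4 * (a * (a + k)) + k * k ≡ (a + (a + k)) * (a + (a + k))
    identity = solve-∀
  ... | inj₂ b≤a with k , refl ← m≤n⇒∃[o]m+o≡n b≤a = subst (4 * ((b + k) * b) ≤_) (identity b k) (m≤m+n _ (k * k))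
    where
    identity : ∀ b k → 4 * ((b + k) * b) + k * k ≡ (b + k + b) * (b + k + b)
    identity = solve-∀

  AM-GM₄ : ∀ a b c d → 256 * (a * (b * (c * d))) ≤ (a + b + (c + d)) ^ 4
  AM-GM₄ a b c d = begin
    256 * (a * (b * (c * d)))                   ≡⟨ split a b c d ⟩
    16 * (4 * (a * b) * (4 * (c * d)))          ≤⟨ *-monoʳ-≤ 16 (*-mono-≤ (4*a*b≤[a+b]² a b) (4*a*b≤[a+b]² c d)) ⟩
    16 * (p * p * (q * q))                      ≡⟨ regroup p q ⟩
    4 * (p * q) * (4 * (p * q))                 ≤⟨ *-mono-≤ (4*a*b≤[a+b]² p q) (4*a*b≤[a+b]² p q) ⟩
    (p + q) * (p + q) * ((p + q) * (p + q))     ≡⟨ fourth (p + q) ⟩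
    (p + q) ^ 4                                 ∎
    where
    open ≤-Reasoning
    p = a + b
    q = c + d
    split : ∀ a b c d → 256 * (a * (b * (c * d))) ≡ 16 * (4 * (a * b) * (4 * (c * d)))
    split = solve-∀
    regroup : ∀ p q → 16 * (p * p * (q * q)) ≡ 4 * (p * q) * (4 * (p * q))
    regroup = solve-∀
    fourth : ∀ x → x * x * (x * x) ≡ x * (x * (x * (x * 1)))
    fourth = solve-∀

  module _ (n T D u : ℕ) (u≡625 : u ≡ 625) .{{_ : NonZero n}} where
    private
      instance
        u≢0 : NonZero u
        u≢0 = subst NonZero (sym u≡625) _
      n⁴ = n ^ 4
      B = D * n + n
      instance
        n⁴≢0 : NonZero n⁴
        n⁴≢0 = m^n≢0 n 4
        n³≢0 : NonZero (n ^ 3)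
        n³≢0 = m^n≢0 n 3

    -- If w exceeded (1 + 1/D)n/5, the four other classes would have at most s ≤ (4 - 1/D)n/5
    -- vertices together, and AM-GM, with `c` = 256, would put X below (1 - 1/(4D))⁴(n/5)⁴. This
    -- loss of about 1/D beats the loss k/(10T) allowed by the lower bound on X.
    classUpper : ∀ D₄ c k {X s w} → D₄ + 1 ≡ 4 * D →
      10 * (T * D₄ ^ 4) + k * (c * D ^ 4) < 10 * (T * (c * D ^ 4)) →
      c * X ≤ s ^ 4 → s + w ≤ n → 10 * (T * n⁴) ≤ 10 * (u * (T * X)) + k * n⁴ →
      5 * D * w ≤ B
    classUpper D₄ c k {X} {s} {w} D₄+1 numeric X≤s⁴ s+w≤n many with 5 * D * w ≤? B
    ... | yes ≤B = ≤B
    ... | no  ≰B = ⊥-elim (<⇒≱ (*-monoˡ-< n⁴ numeric) (begin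
      10 * (T * (c * D ^ 4)) * n⁴
        ≡⟨ l₁ T c (D ^ 4) n⁴ ⟩
      c * D ^ 4 * (10 * (T * n⁴))
        ≤⟨ *-monoʳ-≤ (c * D ^ 4) many ⟩
      c * D ^ 4 * (10 * (u * (T * X)) + k * n⁴)
        ≡⟨ l₂ c (D ^ 4) u T X k n⁴ ⟩
      10 * (T * (u * (D ^ 4 * (c * X)))) + k * (c * D ^ 4) * n⁴
        ≤⟨ +-monoˡ-≤ _ (*-monoʳ-≤ 10 (*-monoʳ-≤ T (*-monoʳ-≤ u (*-monoʳ-≤ (D ^ 4) X≤s⁴)))) ⟩
      10 * (T * (u * (D ^ 4 * s ^ 4))) + k * (c * D ^ 4) * n⁴
        ≡⟨ cong (λ z → 10 * (T * z) + k * (c * D ^ 4) * n⁴) (trans (cong (_* (D ^ 4 * s ^ 4)) u≡625) (l₃ D s)) ⟩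
      10 * (T * (5 * D * s) ^ 4) + k * (c * D ^ 4) * n⁴
        ≤⟨ +-monoˡ-≤ _ (*-monoʳ-≤ 10 (*-monoʳ-≤ T (^-monoˡ-≤ 4 5Ds≤D₄n))) ⟩
      10 * (T * (D₄ * n) ^ 4) + k * (c * D ^ 4) * n⁴
        ≡⟨ l₄ T D₄ n (k * (c * D ^ 4)) ⟩
      (10 * (T * D₄ ^ 4) + k * (c * D ^ 4)) * n⁴ ∎))
      where
      open ≤-Reasoning
      l₁ : ∀ t c d m → 10 * (t * (c * d)) * m ≡ c * d * (10 * (t * m))
      l₁ = solve-∀
      l₂ : ∀ c d u t x k m → c * d * (10 * (u * (t * x)) + k * m) ≡ 10 * (t * (u * (d * (c * x)))) + k * (c * d) * m
      l₂ = solve-∀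
      l₃ : ∀ d s → 625 * (d * (d * (d * (d * 1))) * (s * (s * (s * (s * 1))))) ≡
           5 * d * s * (5 * d * s * (5 * d * s * (5 * d * s * 1)))
      l₃ = solve-∀
      l₄ : ∀ t d n k → 10 * (t * (d * n * (d * n * (d * n * (d * n * 1))))) + k * (n * (n * (n * (n * 1)))) ≡
           (10 * (t * (d * (d * (d * (d * 1))))) + k) * (n * (n * (n * (n * 1))))
      l₄ = solve-∀
      identity : ∀ d s n w → 5 * d * s + n + (5 * d * n + 5 * d * w) ≡ 4 * d * n + (5 * d * (s + w) + (d * n + n))
      identity = solve-∀
      5Ds≤D₄n : 5 * D * s ≤ D₄ * n
      5Ds≤D₄n = +-cancelʳ-≤ n _ _ (≤-trans
        (combine (+-mono-≤ (*-monoʳ-≤ (5 * D) s+w≤n) (<⇒≤ (≰⇒> ≰B))) (identity D s n w))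
        (≤-reflexive (trans (cong (_* n) (sym D₄+1)) (trans (*-distribʳ-+ n D₄ 1) (cong (_+_ (D₄ * n)) (*-identityˡ n))))))

    cube-bound : ∀ {a b c} → 5 * D * a ≤ B → 5 * D * b ≤ B → 5 * D * c ≤ B → 125 * (D ^ 3 * (a * (b * c))) ≤ (D + 1) ^ 3 * n ^ 3
    cube-bound {a} {b} {c} a≤ b≤ c≤ = begin
      125 * (D ^ 3 * (a * (b * c)))         ≡⟨ split D a b c ⟩
      5 * D * a * (5 * D * b * (5 * D * c)) ≤⟨ *-mono-≤ a≤ (*-mono-≤ b≤ c≤) ⟩
      B * (B * B)                           ≡⟨ collect D n ⟩
      (D + 1) ^ 3 * n ^ 3                   ∎
      where
      open ≤-Reasoning
      split : ∀ d a b c → 125 * (d * (d * (d * 1)) * (a * (b * c))) ≡ 5 * d * a * (5 * d * b * (5 * d * c))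
      split = solve-∀
      collect : ∀ d n → (d * n + n) * ((d * n + n) * (d * n + n)) ≡ (d + 1) * ((d + 1) * ((d + 1) * 1)) * (n * (n * (n * 1)))
      collect = solve-∀

    -- The product of four factors is almost (n/5)⁴ and three of them are at most (1 + 1/D)n/5, so
    -- the fourth cannot fall below (1 - 1/E)n/5 once 1/E outweighs 3/D + k/(10T).
    neighboursLower : ∀ E E₁ k {r a b c} → E₁ + 1 ≡ E →
      10 * (T * ((D + 1) ^ 3 * E₁)) + k * (D ^ 3 * E) < 10 * (T * (D ^ 3 * E)) →
      5 * D * a ≤ B → 5 * D * b ≤ B → 5 * D * c ≤ B →
      10 * (T * n⁴) ≤ 10 * (u * (T * (r * (a * (b * c))))) + k * n⁴ →
      E * n ≤ 5 * E * r + n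
    neighboursLower E E₁ k {r} {a} {b} {c} E₁+1 numeric a≤ b≤ c≤ many with E * n ≤? 5 * E * r + n
    ... | yes le = le
    ... | no  ≰  = ⊥-elim (<⇒≱ (*-monoˡ-< n⁴ numeric) (begin
      10 * (T * (D ^ 3 * E)) * n⁴
        ≡⟨ l₁ T (D ^ 3) E n⁴ ⟩
      D ^ 3 * E * (10 * (T * n⁴))
        ≤⟨ *-monoʳ-≤ (D ^ 3 * E) many ⟩
      D ^ 3 * E * (10 * (u * (T * (r * (a * (b * c))))) + k * n⁴)
        ≡⟨ cong (λ v → D ^ 3 * E * (10 * (v * (T * (r * (a * (b * c))))) + k * n⁴)) u≡625 ⟩
      D ^ 3 * E * (10 * (625 * (T * (r * (a * (b * c))))) + k * n⁴)
        ≡⟨ l₂ (D ^ 3) E T r (a * (b * c)) k n⁴ ⟩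
      10 * (T * (5 * E * r) * (125 * (D ^ 3 * (a * (b * c))))) + k * (D ^ 3 * E) * n⁴
        ≤⟨ +-monoˡ-≤ _ (*-monoʳ-≤ 10 (*-mono-≤ (*-monoʳ-≤ T 5Er≤E₁n) (cube-bound a≤ b≤ c≤))) ⟩
      10 * (T * (E₁ * n) * ((D + 1) ^ 3 * n ^ 3)) + k * (D ^ 3 * E) * n⁴
        ≡⟨ l₃ T E₁ n ((D + 1) ^ 3) (k * (D ^ 3 * E)) ⟩
      (10 * (T * ((D + 1) ^ 3 * E₁)) + k * (D ^ 3 * E)) * n⁴ ∎))
      where
      open ≤-Reasoning
      l₁ : ∀ t d e m → 10 * (t * (d * e)) * m ≡ d * e * (10 * (t * m))
      l₁ = solve-∀
      l₂ : ∀ d e t r x k m → d * e * (10 * (625 * (t * (r * x))) + k * m) ≡ 10 * (t * (5 * e * r) * (125 * (d * x))) + k * (d * e) * m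
      l₂ = solve-∀
      l₃ : ∀ t e n c k → 10 * (t * (e * n) * (c * (n * (n * (n * 1))))) + k * (n * (n * (n * (n * 1)))) ≡
           (10 * (t * (c * e)) + k) * (n * (n * (n * (n * 1))))
      l₃ = solve-∀
      5Er≤E₁n : 5 * E * r ≤ E₁ * n
      5Er≤E₁n = +-cancelʳ-≤ n _ _ (≤-trans (<⇒≤ (≰⇒> ≰))
        (≤-reflexive (trans (cong (_* n) (sym E₁+1)) (trans (*-distribʳ-+ n E₁ 1) (cong (_+_ (E₁ * n)) (*-identityˡ n))))))

    -- `r` and `r′` count disjoint parts of a class of size w. With r′ at least (1 - 1/E)n/5 and w
    -- at most (1 + 1/E)n/5, at most 2n/(5E) is left for r.
    smallClass : ∀ E {{_ : NonZero D}} {r r′ w} → E ≤ D →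
      5 * D * w ≤ B → E * n ≤ 5 * E * r′ + n → r + r′ ≤ w → 5 * E * r ≤ 2 * n
    smallClass E {r} {r′} {w} E≤D w≤ r′≥ r+r′≤w = combine
      (+-mono-≤ (+-mono-≤ 5Ew≤ r′≥) (*-monoʳ-≤ (5 * E) r+r′≤w)) (identity E r r′ w n)
      where
      5Ew≤ : 5 * E * w ≤ E * n + n
      5Ew≤ = *-cancelˡ-≤ D (begin
        D * (5 * E * w)    ≡⟨ l₁ D E w ⟩
        E * (5 * D * w)    ≤⟨ *-monoʳ-≤ E w≤ ⟩
        E * (D * n + n)    ≡⟨ l₂ D E n ⟩
        D * (E * n) + E * n ≤⟨ +-monoʳ-≤ (D * (E * n)) (*-monoˡ-≤ n E≤D) ⟩
        D * (E * n) + D * n ≡⟨ *-distribˡ-+ D (E * n) n ⟨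
        D * (E * n + n)    ∎)
        where
        open ≤-Reasoning
        l₁ : ∀ d e w → d * (5 * e * w) ≡ e * (5 * d * w)
        l₁ = solve-∀
        l₂ : ∀ d e n → e * (d * n + n) ≡ d * (e * n) + e * n
        l₂ = solve-∀
      identity : ∀ e r r′ w n → 5 * e * r + (e * n + n + (5 * e * r′ + n) + 5 * e * w) ≡ 2 * n + (5 * e * w + e * n + 5 * e * (r + r′))
      identity = solve-∀

    -- About 2(n/5)⁴ walks are required. If 2r ≤ w, the term 2rr′ab is at most about (n/5)⁴, and the
    -- error term is at most 2000/E times (n/5)⁴, so the total falls short by a wide margin.
    halfClass : ∀ E {walks β r r′ w a b} →
      16 * u * (T * D ^ 4) + 5 * (T * (E * (D + 1) ^ 4)) + E * D ^ 4 < 10 * (T * (E * D ^ 4)) →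
      10 * (T * n⁴) ≤ 5 * u * (T * walks) + n⁴ →
      walks ≤ β * n ^ 3 + 2 * (r * (r′ * (a * b))) → 5 * E * β ≤ 16 * n →
      5 * D * w ≤ B → 5 * D * r′ ≤ B → 5 * D * a ≤ B → 5 * D * b ≤ B → w < 2 * r
    halfClass E {walks} {β} {r} {r′} {w} {a} {b} numeric many walks≤ β≤ w≤ r′≤ a≤ b≤ with w <? 2 * r
    ... | yes lt = lt
    ... | no  ≮  = ⊥-elim (<⇒≱ (*-monoˡ-< (2 * u * n⁴) {{m*n≢0 (2 * u) n⁴ {{m*n≢0 2 u}}}} numeric) (begin
      10 * (T * (E * d)) * (2 * u * n⁴)
        ≡⟨ l₁ u T E d n⁴ ⟩
      2 * u * E * d * (10 * (T * n⁴))
        ≤⟨ *-monoʳ-≤ (2 * u * E * d) many ⟩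
      2 * u * E * d * (5 * u * (T * walks) + n⁴)
        ≡⟨ l₂ u T E d walks n⁴ ⟩
      2 * u * u * d * T * (5 * E * walks) + 2 * u * E * d * n⁴
        ≤⟨ +-monoˡ-≤ _ (*-monoʳ-≤ (2 * u * u * d * T) 5E*walks≤) ⟩
      2 * u * u * d * T * (16 * n⁴ + 10 * (E * X)) + 2 * u * E * d * n⁴
        ≡⟨ l₃ u T E d X n⁴ ⟩
      32 * u * u * d * T * n⁴ + 10 * u * T * E * (2 * (u * (d * X))) + 2 * u * E * d * n⁴
        ≤⟨ +-monoˡ-≤ _ (+-monoʳ-≤ (32 * u * u * d * T * n⁴) (*-monoʳ-≤ (10 * u * T * E) X≤)) ⟩
      32 * u * u * d * T * n⁴ + 10 * u * T * E * ((D + 1) ^ 4 * n⁴) + 2 * u * E * d * n⁴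
        ≡⟨ l₄ u T E d ((D + 1) ^ 4) n⁴ ⟩
      (16 * u * (T * d) + 5 * (T * (E * (D + 1) ^ 4)) + E * d) * (2 * u * n⁴) ∎))
      where
      open ≤-Reasoning
      d = D ^ 4
      X = r * (r′ * (a * b))
      l₁ : ∀ u t e d m → 10 * (t * (e * d)) * (2 * u * m) ≡ 2 * u * e * d * (10 * (t * m))
      l₁ = solve-∀
      l₂ : ∀ u t e d w m → 2 * u * e * d * (5 * u * (t * w) + m) ≡ 2 * u * u * d * t * (5 * e * w) + 2 * u * e * d * m
      l₂ = solve-∀
      l₃ : ∀ u t e d x m → 2 * u * u * d * t * (16 * m + 10 * (e * x)) + 2 * u * e * d * m ≡
           32 * u * u * d * t * m + 10 * u * t * e * (2 * (u * (d * x))) + 2 * u * e * d * m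
      l₃ = solve-∀
      l₄ : ∀ u t e d c m → 32 * u * u * d * t * m + 10 * u * t * e * (c * m) + 2 * u * e * d * m ≡
           (16 * u * (t * d) + 5 * (t * (e * c)) + e * d) * (2 * u * m)
      l₄ = solve-∀
      5E*walks≤ : 5 * E * walks ≤ 16 * n⁴ + 10 * (E * X)
      5E*walks≤ = begin
        5 * E * walks                           ≤⟨ *-monoʳ-≤ (5 * E) walks≤ ⟩
        5 * E * (β * n ^ 3 + 2 * X)             ≡⟨ k₁ E β (n ^ 3) X ⟩
        5 * E * β * n ^ 3 + 10 * (E * X)        ≤⟨ +-monoˡ-≤ _ (*-monoˡ-≤ (n ^ 3) β≤) ⟩
        16 * n * n ^ 3 + 10 * (E * X)           ≡⟨ cong (_+ 10 * (E * X)) (*-assoc 16 n (n ^ 3)) ⟩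
        16 * n⁴ + 10 * (E * X)                  ∎
        where
        k₁ : ∀ e b n x → 5 * e * (b * n + 2 * x) ≡ 5 * e * b * n + 10 * (e * x)
        k₁ = solve-∀
      X≤ : 2 * (u * (d * X)) ≤ (D + 1) ^ 4 * n⁴
      X≤ = begin
        2 * (u * (d * X))                                       ≡⟨ trans (cong (λ v → 2 * (v * (d * X))) u≡625) (k₂ D r r′ a b) ⟩
        5 * D * (2 * r) * (125 * (D ^ 3 * (r′ * (a * b))))        ≤⟨ *-mono-≤ (≤-trans (*-monoʳ-≤ (5 * D) (≮⇒≥ ≮)) w≤) (cube-bound r′≤ a≤ b≤) ⟩
        B * ((D + 1) ^ 3 * n ^ 3)                                 ≡⟨ k₃ D n ((D + 1) ^ 3) (n ^ 3) ⟩
        (D + 1) ^ 4 * n⁴                                          ∎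
        where
        k₂ : ∀ d r s a b → 2 * (625 * (d * (d * (d * (d * 1))) * (r * (s * (a * b))))) ≡
             5 * d * (2 * r) * (125 * (d * (d * (d * 1)) * (s * (a * b))))
        k₂ = solve-∀
        k₃ : ∀ d n c m → (d * n + n) * (c * m) ≡ (d + 1) * c * (n * m)
        k₃ = solve-∀

-- Finite facts about C₅, verified by enumeration

module FiveCycle where
  open Certificate using (⟦_⟧)
  next prev : Fin 5 → Fin 5
  next 0F = 1F
  next 1F = 2F
  next 2F = 3F
  next 3F = 4F
  next 4F = 0F
  prev 0F = 4F
  prev 1F = 0F
  prev 2F = 1F
  prev 3F = 2F
  prev 4F = 3F

  Near : Fin 5 → Fin 5 → Set
  Near j i = i ≡ prev j ⊎ i ≡ next j

  near? : ∀ j i → Dec (Near j i)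
  near? j i = (i ≟ prev j) ⊎-dec (i ≟ next j)

  C5adj? : ∀ i j → Dec (C5adj i j)
  C5adj? i j = ((_ ℕP.≟ _) ⊎-dec (_ ℕP.≟ _))

  opaque
    C5adj⇒near : ∀ i j → C5adj i j → Near i j
    C5adj⇒near = from-yes (all? λ i → all? λ j → C5adj? i j →-dec near? i j)

    -- C₅ has diameter two, and a vertex shares its neighbours with itself. This is what makes
    -- triangle-freeness strong enough to force colours to be adjacent.
    adjacent-or-common : ∀ i j → C5adj i j ⊎ ∃ λ t → Near i t × Near j t
    adjacent-or-common = from-yes (all? λ i → all? λ j → C5adj? i j ⊎-dec any? λ t → near? i t ×-dec near? j t)

    -- The five steps ±1 of the closed walk j, a, x, y, b add up to an odd multiple of 5, hence to
    -- ±5: the walk goes once round, in one direction or the other.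
    long-way-round : ∀ j a x y b → Near j a → Near j b → C5adj a x → C5adj x y → C5adj y b →
      (a ≡ prev j × x ≡ prev (prev j) × y ≡ next (next j) × b ≡ next j) ⊎
      (a ≡ next j × x ≡ next (next j) × y ≡ prev (prev j) × b ≡ prev j)
    long-way-round = from-yes (all? λ j → all? λ a → all? λ x → all? λ y → all? λ b →
      near? j a →-dec (near? j b →-dec (C5adj? a x →-dec (C5adj? x y →-dec (C5adj? y b →-dec
        (((a ≟ prev j) ×-dec ((x ≟ prev (prev j)) ×-dec ((y ≟ next (next j)) ×-dec (b ≟ next j)))) ⊎-dec
         ((a ≟ next j) ×-dec ((x ≟ next (next j)) ×-dec ((y ≟ prev (prev j)) ×-dec (b ≟ prev j))))))))))

    prev-prev-prev : ∀ k → prev (prev (prev k)) ≡ next (next k)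
    prev-prev-prev = from-yes (all? λ k → prev (prev (prev k)) ≟ next (next k))

    prev-next : ∀ k → prev (next k) ≡ k
    prev-next = from-yes (all? λ k → prev (next k) ≟ k)

    next-prev : ∀ k → next (prev k) ≡ k
    next-prev = from-yes (all? λ k → next (prev k) ≟ k)

    classes-disjoint : ∀ j k → ⟦ eqb k (prev j) ⟧ Nat.+ ⟦ eqb k (next j) ⟧ Nat.+
      (⟦ eqb k (prev (prev j)) ⟧ Nat.+ ⟦ eqb k (next (next j)) ⟧) Nat.+ ⟦ eqb k j ⟧ Nat.≤ 1
    classes-disjoint = from-yes (all? λ j → all? λ k → (⟦ eqb k (prev j) ⟧ Nat.+ ⟦ eqb k (next j) ⟧ Nat.+
      (⟦ eqb k (prev (prev j)) ⟧ Nat.+ ⟦ eqb k (next (next j)) ⟧) Nat.+ ⟦ eqb k j ⟧) ℕP.≤? 1)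

    classes-cover : ∀ j k → ⟦ not (eqb k (prev j) ∨ eqb k (next j)) ⟧ Nat.≤
      ⟦ eqb k j ⟧ Nat.+ (⟦ eqb k (prev (prev j)) ⟧ Nat.+ ⟦ eqb k (next (next j)) ⟧)
    classes-cover = from-yes (all? λ j → all? λ k → ⟦ not (eqb k (prev j) ∨ eqb k (next j)) ⟧ ℕP.≤?
      (⟦ eqb k j ⟧ Nat.+ (⟦ eqb k (prev (prev j)) ⟧ Nat.+ ⟦ eqb k (next (next j)) ⟧)))

    common-neighbour : ∀ k j → C5adj (prev k) j → C5adj (next k) j → j ≡ k
    common-neighbour = from-yes (all? λ k → all? λ j → C5adj? (prev k) j →-dec (C5adj? (next k) j →-dec (j ≟ k)))

module BoolLemmas where
  open Certificate using (⟦_⟧)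
  open import Data.Nat.Base

  indicator-≤ : ∀ b {m} → (b ≡ true → 1 ≤ m) → ⟦ b ⟧ ≤ m
  indicator-≤ true  1≤m = 1≤m refl
  indicator-≤ false _   = z≤n

  indicator-1 : ∀ {b} → b ≡ true → 1 ≤ ⟦ b ⟧
  indicator-1 refl = s≤s z≤n

  ∧-true : ∀ {a b} → a ∧ b ≡ true → a ≡ true × b ≡ true
  ∧-true {true} {true} _ = refl , refl

  ∧-intro : ∀ {a b} → a ≡ true → b ≡ true → a ∧ b ≡ true
  ∧-intro refl refl = refl

  eqb-sound : ∀ {m} {i j : Fin m} → eqb i j ≡ true → i ≡ j
  eqb-sound {i = i} {j} eq with i ≟ j
  ... | yes i≡j = i≡j

  eqb-refl : ∀ {m} (i : Fin m) → eqb i i ≡ true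
  eqb-refl i with i ≟ i
  ... | yes _ = refl
  ... | no ≢  = ⊥-elim (≢ refl)

-- The hierarchy of constants

module Constants where
  open import Data.Nat.Base
  open ℕP using (≤ᵇ⇒≤)

  -- T : all but n/T vertices are coloured;        D : colour classes have at most (1 + 1/D)n/5 vertices;
  -- E : a vertex of colour j has at least (1 − 1/E)n/5 neighbours in each of classes j ± 1;        ε = 1/Q.
  record Scales : Set where
    field
      T Q D E D₄ E₁ u : ℕ
      u≡625 : u ≡ 625
      Q≡1000T² : Q ≡ T * T * 1000
      D₄+1 : D₄ + 1 ≡ 4 * D
      E₁+1 : E₁ + 1 ≡ E
      D≢0 : NonZero D
      T≢0 : NonZero T
      E≤D : E ≤ D
      20E≤T : 20 * E ≤ T
      upperFact : 10 * (T * D₄ ^ 4) + (20 * u + 1) * (256 * D ^ 4) < 10 * (T * (256 * D ^ 4))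
      lowerFact : 10 * (T * ((D + 1) ^ 3 * E₁)) + (20 * u + 1) * (D ^ 3 * E) < 10 * (T * (D ^ 3 * E))
      halfFact : 16 * u * (T * D ^ 4) + 5 * (T * (E * (D + 1) ^ 4)) + E * D ^ 4 < 10 * (T * (E * D ^ 4))

  opaque
    -- Each scale absorbs the errors of the previous one: (20u + 1)/(10T), about 10⁻⁶, is below 1/D
    -- = 10⁻⁵; 3/D plus that error is below 1/E = 10⁻⁴; and `halfFact` amounts to 10000/E + 5 < 10
    -- up to tiny terms.
    scales : Scales
    scales = record
      { T = 1000000000 ; Q = 1000000000000000000000 ; D = 100000 ; E = 10000 ; D₄ = 399999 ; E₁ = 9999 ; u = 625
      ; u≡625 = refl ; Q≡1000T² = refl ; D₄+1 = refl ; E₁+1 = refl ; D≢0 = _ ; T≢0 = _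
      ; E≤D = ≤ᵇ⇒≤ _ _ _ ; 20E≤T = ≤ᵇ⇒≤ _ _ _
      ; upperFact = ≤ᵇ⇒≤ _ _ _ ; lowerFact = ≤ᵇ⇒≤ _ _ _ ; halfFact = ≤ᵇ⇒≤ _ _ _ }

-- From a colouring of almost all vertices to a homomorphism

module PartialColouring where
  open Certificate using (⟦_⟧)
  open import Data.Nat.Base
  open ℕP using (module ≤-Reasoning; m≤m+n; m≤n+m; ≤-trans; ≤-refl; ≤-reflexive; +-mono-≤; +-monoˡ-≤;
                 *-mono-≤; *-monoʳ-≤; *-monoˡ-≤; *-identityʳ; +-identityʳ; _≤?_; <⇒≱; +-mono-<)
  open ∑ℕ
  open NatSums
  open Walks
  open Linear
  open Estimates
  open FiveCycle
  open BoolLemmas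
  open Constants

  ≥1-sum₆ : ∀ a b c d e f → 1 ≤ a ⊎ 1 ≤ b ⊎ 1 ≤ c ⊎ 1 ≤ d ⊎ 1 ≤ e ⊎ 1 ≤ f → 1 ≤ a + b + c + d + e + f
  ≥1-sum₆ a b c d e f = λ where
      (inj₁ 1≤a)                             → left f (left e (left d (left c (left b 1≤a))))
      (inj₂ (inj₁ 1≤b))                      → left f (left e (left d (left c (right a 1≤b))))
      (inj₂ (inj₂ (inj₁ 1≤c)))               → left f (left e (left d (right (a + b) 1≤c)))
      (inj₂ (inj₂ (inj₂ (inj₁ 1≤d))))        → left f (left e (right (a + b + c) 1≤d))
      (inj₂ (inj₂ (inj₂ (inj₂ (inj₁ 1≤e))))) → left f (right (a + b + c + d) 1≤e)
      (inj₂ (inj₂ (inj₂ (inj₂ (inj₂ 1≤f))))) → right (a + b + c + d + e) 1≤f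
    where
    left : ∀ {x} y → 1 ≤ x → 1 ≤ x + y
    left {x} y 1≤x = ≤-trans 1≤x (m≤m+n x y)
    right : ∀ x {y} → 1 ≤ y → 1 ≤ x + y
    right x {y} 1≤y = ≤-trans 1≤y (m≤n+m y x)

  hasColour : Maybe (Fin 5) → Fin 5 → Bool
  hasColour nothing  i = false
  hasColour (just k) i = eqb k i

  none : Maybe (Fin 5) → Bool
  none nothing  = true
  none (just _) = false

  hasColour-sound : ∀ {m i} → hasColour m i ≡ true → m ≡ just i
  hasColour-sound {just k} eq = cong just (eqb-sound eq)

  hasColour-complete : ∀ {m i} → m ≡ just i → hasColour m i ≡ true
  hasColour-complete {i = i} refl = eqb-refl i

  module _ {n : ℕ} where
    ∑₄ : (Fin n → Fin n → Fin n → Fin n → ℕ) → ℕ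
    ∑₄ f = ∑ λ u → ∑ λ x → ∑ λ y → ∑ λ w → f u x y w

    ∑₄-+ : ∀ f g → ∑₄ (λ u x y w → f u x y w + g u x y w) ≡ ∑₄ f + ∑₄ g
    ∑₄-+ f g = trans (∑-cong λ u → trans (∑-cong λ x → trans (∑-cong λ y →
      ∑-+ _ _) (∑-+ _ _)) (∑-+ _ _)) (∑-+ _ _)

    ∑₄-+₆ : ∀ f₁ f₂ f₃ f₄ f₅ f₆ →
      ∑₄ (λ u x y w → f₁ u x y w + f₂ u x y w + f₃ u x y w + f₄ u x y w + f₅ u x y w + f₆ u x y w)
        ≡ ∑₄ f₁ + ∑₄ f₂ + ∑₄ f₃ + ∑₄ f₄ + ∑₄ f₅ + ∑₄ f₆
    ∑₄-+₆ f₁ f₂ f₃ f₄ f₅ f₆ =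
      trans (∑₄-+ _ f₆) (cong (_+ ∑₄ f₆) (trans (∑₄-+ _ f₅) (cong (_+ ∑₄ f₅) (trans (∑₄-+ _ f₄) (cong (_+ ∑₄ f₄)
        (trans (∑₄-+ _ f₃) (cong (_+ ∑₄ f₃) (∑₄-+ f₁ f₂))))))))

    ∑₄-product : ∀ (p q r s : Fin n → ℕ) →
      ∑₄ (λ u x y w → p u * (q x * (r y * s w))) ≡ ∑ p * (∑ q * (∑ r * ∑ s))
    ∑₄-product p q r s =
      trans (∑-cong λ u → trans (∑-cong λ x → trans (∑-cong λ y →
        trans (∑-*ˡ (p u) _) (cong (p u *_) (trans (∑-*ˡ (q x) _) (cong (q x *_) (∑-*ˡ (r y) s)))))
        (trans (∑-*ˡ (p u) _) (cong (p u *_) (trans (∑-*ˡ (q x) _) (cong (q x *_) (∑-*ʳ (∑ s) r))))))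
        (trans (∑-*ˡ (p u) _) (cong (p u *_) (∑-*ʳ (∑ r * ∑ s) q))))
        (∑-*ʳ (∑ q * (∑ r * ∑ s)) p)

    ∑-one : ∑ {n} (λ _ → 1) ≡ n
    ∑-one = trans (∑-const n 1) (*-identityʳ n)

  module _ {n : ℕ} (G : Graph n) (tf : TriangleFree G) (col : Fin n → Maybe (Fin 5))
           (hom : ∀ x y {i k} → adj G x y ≡ true → col x ≡ just i → col y ≡ just k → C5adj i k) where

    inClass : Fin n → Fin 5 → Bool
    inClass x i = hasColour (col x) i

    size : Fin 5 → ℕ
    size i = ∑ λ x → ⟦ inClass x i ⟧

    neighbours : Fin n → Fin 5 → ℕ
    neighbours v i = ∑ λ x → ⟦ adj G v x ∧ inClass x i ⟧

    uncoloured : ℕ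
    uncoloured = ∑ λ x → ⟦ none (col x) ⟧

    -- Neighbours of v outside the two classes they would belong to if v had colour j.
    isStray : Fin n → Fin 5 → Fin n → Bool
    isStray v j x = adj G v x ∧ not (inClass x (prev j) ∨ inClass x (next j))

    strays : Fin n → Fin 5 → ℕ
    strays v j = ∑ λ x → ⟦ isStray v j x ⟧

    -- An upper estimate for the closed walks from v through classes j - 1, j - 2, j + 2, j + 1 in
    -- this order: the outer two vertices must be neighbours of v, the middle two need only lie in
    -- their classes.
    mainTerm : Fin n → Fin 5 → ℕ
    mainTerm v j = neighbours v (prev j) * (neighbours v (next j) * (size (prev (prev j)) * size (next (next j))))

    error : Fin n → Fin 5 → ℕ
    error v j = strays v j + strays v j + uncoloured + uncoloured

    coloured? : ∀ x → 1 ≤ ⟦ none (col x) ⟧ ⊎ ∃ λ k → col x ≡ just k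
    coloured? x with col x
    ... | nothing = inj₁ ≤-refl
    ... | just k  = inj₂ (k , refl)

    module _ (v : Fin n) (j : Fin 5) where
      private
        B R P Q PP QQ : Fin n → ℕ
        B x = ⟦ isStray v j x ⟧
        R x = ⟦ none (col x) ⟧
        P x = ⟦ adj G v x ∧ inClass x (prev j) ⟧
        Q x = ⟦ adj G v x ∧ inClass x (next j) ⟧
        PP x = ⟦ inClass x (prev (prev j)) ⟧
        QQ x = ⟦ inClass x (next (next j)) ⟧

        -- The four kinds of defective walk and the two directions round the cycle. The factors 1
        -- give all six the product shape that `∑₄-product` expects.
        t₁ t₂ t₃ t₄ t₅ t₆ : Fin n → Fin n → Fin n → Fin n → ℕ
        t₁ u x y w = B u * (1 * (1 * 1))
        t₂ u x y w = 1 * (1 * (1 * B w))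
        t₃ u x y w = 1 * (R x * (1 * 1))
        t₄ u x y w = 1 * (1 * (R y * 1))
        t₅ u x y w = P u * (PP x * (QQ y * Q w))
        t₆ u x y w = Q u * (QQ x * (PP y * P w))

        nearby : ∀ u → adj G v u ≡ true → 1 ≤ B u ⊎ ∃ λ a → Near j a × col u ≡ just a
        nearby u vu with inClass u (prev j) in p | inClass u (next j) in q
        ... | true  | _     = inj₂ (prev j , inj₁ refl , hasColour-sound p)
        ... | false | true  = inj₂ (next j , inj₂ refl , hasColour-sound q)
        ... | false | false rewrite vu = inj₁ (s≤s z≤n)

        coloured : ∀ {x i} → col x ≡ just i → 1 ≤ ⟦ inClass x i ⟧
        coloured cx = indicator-1 (hasColour-complete cx)

        neighbour : ∀ {x i} → adj G v x ≡ true → col x ≡ just i → 1 ≤ ⟦ adj G v x ∧ inClass x i ⟧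
        neighbour vx cx = indicator-1 (∧-intro vx (hasColour-complete cx))

        walk-covered : ∀ u x y w → isWalk G v u x y w ≡ true →
          1 ≤ t₁ u x y w ⊎ 1 ≤ t₂ u x y w ⊎ 1 ≤ t₃ u x y w ⊎ 1 ≤ t₄ u x y w ⊎ 1 ≤ t₅ u x y w ⊎ 1 ≤ t₆ u x y w
        walk-covered u x y w walk
          with vu , rest ← ∧-true {adj G v u} walk
          with ux , rest ← ∧-true {adj G u x} rest
          with xy , rest ← ∧-true {adj G x y} rest
          with yw , wv ← ∧-true {adj G y w} rest
          with nearby u vu | nearby w (trans (symmetric G v w) wv) | coloured? x | coloured? y
        ... | inj₁ 1≤B | _        | _        | _        = inj₁ (*-mono-≤ 1≤B (≤-refl {1}))
        ... | inj₂ _   | inj₁ 1≤B | _        | _        = inj₂ (inj₁ (*-mono-≤ (≤-refl {1}) (*-mono-≤ (≤-refl {1}) (*-mono-≤ (≤-refl {1}) 1≤B))))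
        ... | inj₂ _   | inj₂ _   | inj₁ 1≤R | _        = inj₂ (inj₂ (inj₁ (*-mono-≤ (≤-refl {1}) (*-mono-≤ 1≤R (≤-refl {1})))))
        ... | inj₂ _   | inj₂ _   | inj₂ _   | inj₁ 1≤R = inj₂ (inj₂ (inj₂ (inj₁ (*-mono-≤ (≤-refl {1}) (*-mono-≤ (≤-refl {1}) (*-mono-≤ 1≤R (≤-refl {1})))))))
        ... | inj₂ (a , na , ca) | inj₂ (b , nb , cb) | inj₂ (k , ck) | inj₂ (l , cl)
          with long-way-round j a k l b na nb (hom u x ux ca ck) (hom x y xy ck cl) (hom y w yw cl cb)
        ...   | inj₁ (refl , refl , refl , refl) = inj₂ (inj₂ (inj₂ (inj₂ (inj₁
                  (*-mono-≤ (neighbour vu ca) (*-mono-≤ (coloured ck) (*-mono-≤ (coloured cl) (neighbour (trans (symmetric G v w) wv) cb))))))))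
        ...   | inj₂ (refl , refl , refl , refl) = inj₂ (inj₂ (inj₂ (inj₂ (inj₂
                  (*-mono-≤ (neighbour vu ca) (*-mono-≤ (coloured ck) (*-mono-≤ (coloured cl) (neighbour (trans (symmetric G v w) wv) cb))))))))

      -- Here v may be uncoloured and j is any candidate colour. Either a walk has a stray next to
      -- v, at one end or the other, or one of its two middle vertices is uncoloured, or
      -- `long-way-round` applies. Each defect leaves n³ choices for the remaining vertices.
      walks-bound : walks G v ≤ error v j * n ^ 3 + 2 * mainTerm v j
      walks-bound = begin
        ∑₄ (λ u x y w → ⟦ isWalk G v u x y w ⟧)
          ≤⟨ (∑-mono-≤ λ u → ∑-mono-≤ λ x → ∑-mono-≤ λ y → ∑-mono-≤ λ w →
               indicator-≤ (isWalk G v u x y w) λ walk →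
               ≥1-sum₆ (t₁ u x y w) (t₂ u x y w) (t₃ u x y w) (t₄ u x y w) (t₅ u x y w) (t₆ u x y w) (walk-covered u x y w walk)) ⟩
        ∑₄ (λ u x y w → t₁ u x y w + t₂ u x y w + t₃ u x y w + t₄ u x y w + t₅ u x y w + t₆ u x y w)
          ≡⟨ ∑₄-+₆ t₁ t₂ t₃ t₄ t₅ t₆ ⟩
        ∑₄ t₁ + ∑₄ t₂ + ∑₄ t₃ + ∑₄ t₄ + ∑₄ t₅ + ∑₄ t₆
          ≡⟨ cong₂ _+_ (cong₂ _+_ (cong₂ _+_ (cong₂ _+_ (cong₂ _+_
               (∑₄-product B one one one) (∑₄-product one one one B)) (∑₄-product one R one one))
               (∑₄-product one one R one)) (∑₄-product P PP QQ Q)) (∑₄-product Q QQ PP P) ⟩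
        stray * (N * (N * N)) + N * (N * (N * stray)) + N * (uncoloured * (N * N)) + N * (N * (uncoloured * N))
          + p * (pp * (qq * q)) + q * (qq * (pp * p))
          ≡⟨ cong (λ m → stray * (m * (m * m)) + m * (m * (m * stray)) + m * (uncoloured * (m * m))
                    + m * (m * (uncoloured * m)) + p * (pp * (qq * q)) + q * (qq * (pp * p))) ∑-one ⟩
        stray * (n * (n * n)) + n * (n * (n * stray)) + n * (uncoloured * (n * n)) + n * (n * (uncoloured * n))
          + p * (pp * (qq * q)) + q * (qq * (pp * p))
          ≡⟨ collect n stray uncoloured p q pp qq ⟩
        error v j * n ^ 3 + 2 * mainTerm v j ∎
        where
        open ≤-Reasoning
        one : Fin n → ℕ
        one _ = 1
        N = ∑ one
        stray = strays v j
        p = neighbours v (prev j)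
        q = neighbours v (next j)
        pp = size (prev (prev j))
        qq = size (next (next j))
        collect : ∀ n s c p q pp qq →
          s * (n * (n * n)) + n * (n * (n * s)) + n * (c * (n * n)) + n * (n * (c * n)) + p * (pp * (qq * q)) + q * (qq * (pp * p))
          ≡ (s + s + c + c) * (n * (n * (n * 1))) + 2 * (p * (q * (pp * qq)))
        collect = solve-∀

    neighbours≤size : ∀ v i → neighbours v i ≤ size i
    neighbours≤size v i = ∑-mono-≤ λ x → indicator-≤ (adj G v x ∧ inClass x i) λ eq → indicator-1 (proj₂ (∧-true {adj G v x} eq))

    neighbours-disjoint : ∀ r s i → adj G r s ≡ true → neighbours r i + neighbours s i ≤ size i
    neighbours-disjoint r s i rs = subst (_≤ size i) (∑-+ _ _) (∑-mono-≤ pointwise)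
      where
      pointwise : ∀ x → ⟦ adj G r x ∧ inClass x i ⟧ + ⟦ adj G s x ∧ inClass x i ⟧ ≤ ⟦ inClass x i ⟧
      pointwise x with adj G r x in rx | adj G s x in sx
      ... | true  | true  = ⊥-elim (tf r s x rs sx rx)
      ... | true  | false = ≤-reflexive (+-identityʳ _)
      ... | false | true  = ≤-refl
      ... | false | false = z≤n

    sizes-bound : ∀ j → size (prev j) + size (next j) + (size (prev (prev j)) + size (next (next j))) + size j ≤ n
    sizes-bound j = begin
      size (prev j) + size (next j) + (size (prev (prev j)) + size (next (next j))) + size j
        ≡⟨ trans (∑-+ _ _) (cong (_+ size j) (trans (∑-+ _ _) (cong₂ _+_ (∑-+ _ _) (∑-+ _ _)))) ⟨
      ∑ (λ x → ⟦ inClass x (prev j) ⟧ + ⟦ inClass x (next j) ⟧ +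
               (⟦ inClass x (prev (prev j)) ⟧ + ⟦ inClass x (next (next j)) ⟧) + ⟦ inClass x j ⟧)
        ≤⟨ ∑-mono-≤ pointwise ⟩
      ∑ {n} (λ _ → 1)
        ≡⟨ ∑-one ⟩
      n ∎
      where
      open ≤-Reasoning
      pointwise : ∀ x → ⟦ inClass x (prev j) ⟧ + ⟦ inClass x (next j) ⟧ +
                        (⟦ inClass x (prev (prev j)) ⟧ + ⟦ inClass x (next (next j)) ⟧) + ⟦ inClass x j ⟧ ≤ 1
      pointwise x with col x
      ... | nothing = z≤n
      ... | just k  = classes-disjoint j k

    -- The partial colouring is a homomorphism, so a coloured neighbour of v lies in class j - 1 or
    -- j + 1 and is no stray.
    strays-own : ∀ v j → col v ≡ just j → strays v j ≤ uncoloured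
    strays-own v j cv = ∑-mono-≤ λ x → indicator-≤ (isStray v j x) (pointwise x)
      where
      pointwise : ∀ x → isStray v j x ≡ true → 1 ≤ ⟦ none (col x) ⟧
      pointwise x eq with coloured? x
      ... | inj₁ 1≤ = 1≤
      ... | inj₂ (k , cx) with vx , far ← ∧-true {adj G v x} eq
                          with C5adj⇒near j k (hom v x vx cv cx)
      ...   | inj₁ refl rewrite hasColour-complete cx with () ← far
      ...   | inj₂ refl rewrite hasColour-complete cx | BoolP.∨-zeroʳ (inClass x (prev j)) with () ← far

    strays-bound : ∀ v j → strays v j ≤ uncoloured +
      (neighbours v j + (neighbours v (prev (prev j)) + neighbours v (next (next j))))
    strays-bound v j = begin
      strays v j
        ≤⟨ ∑-mono-≤ pointwise ⟩
      ∑ (λ x → ⟦ none (col x) ⟧ + (near x j + (near x (prev (prev j)) + near x (next (next j)))))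
        ≡⟨ trans (∑-+ _ _) (cong (_+_ uncoloured) (trans (∑-+ _ _) (cong (_+_ (neighbours v j)) (∑-+ _ _)))) ⟩
      uncoloured + (neighbours v j + (neighbours v (prev (prev j)) + neighbours v (next (next j)))) ∎
      where
      open ≤-Reasoning
      near : Fin n → Fin 5 → ℕ
      near x i = ⟦ adj G v x ∧ inClass x i ⟧
      pointwise : ∀ x → ⟦ isStray v j x ⟧ ≤ ⟦ none (col x) ⟧ + (near x j + (near x (prev (prev j)) + near x (next (next j))))
      pointwise x with adj G v x | col x
      ... | false | _       = z≤n
      ... | true  | nothing = s≤s z≤n
      ... | true  | just k  = classes-cover j k

    module _ (S : Scales) .{{_ : NonZero n}}
             (many : ∀ v → 10 * (Scales.T S * n ^ 4) ≤ 5 * Scales.u S * (Scales.T S * walks G v) + n ^ 4)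
             (few : Scales.T S * uncoloured ≤ n)
             (inhabited : ∀ j → ∃ λ v → col v ≡ just j) where
      open Scales S

      -- `error` is at most 4 `uncoloured`, hence at most 4n/T, which costs 20u after multiplication
      -- by 5u; the n⁴ in the hypothesis adds the final 1.
      mainTerm-lower : ∀ v j → col v ≡ just j →
        10 * (T * n ^ 4) ≤ 10 * (u * (T * mainTerm v j)) + (20 * u + 1) * n ^ 4
      mainTerm-lower v j cv = begin
        10 * (T * n ^ 4)
          ≤⟨ many v ⟩
        5 * u * (T * walks G v) + n ^ 4
          ≤⟨ +-monoˡ-≤ (n ^ 4) (*-monoʳ-≤ (5 * u) (*-monoʳ-≤ T (≤-trans (walks-bound v j) (+-monoˡ-≤ _ (*-monoˡ-≤ (n ^ 3) error≤))))) ⟩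
        5 * u * (T * (4 * uncoloured * n ^ 3 + 2 * mainTerm v j)) + n ^ 4
          ≡⟨ l₁ u T uncoloured (n ^ 3) (mainTerm v j) (n ^ 4) ⟩
        20 * u * (T * uncoloured * n ^ 3) + 10 * (u * (T * mainTerm v j)) + n ^ 4
          ≤⟨ +-monoˡ-≤ (n ^ 4) (+-monoˡ-≤ (10 * (u * (T * mainTerm v j))) (*-monoʳ-≤ (20 * u) (*-monoˡ-≤ (n ^ 3) few))) ⟩
        20 * u * n ^ 4 + 10 * (u * (T * mainTerm v j)) + n ^ 4
          ≡⟨ l₂ u (n ^ 4) (u * (T * mainTerm v j)) ⟩
        10 * (u * (T * mainTerm v j)) + (20 * u + 1) * n ^ 4 ∎
        where
        open ≤-Reasoning
        l₁ : ∀ u t c n x m → 5 * u * (t * (4 * c * n + 2 * x)) + m ≡ 20 * u * (t * c * n) + 10 * (u * (t * x)) + m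
        l₁ = solve-∀
        l₂ : ∀ u m x → 20 * u * m + 10 * x + m ≡ 10 * x + (20 * u + 1) * m
        l₂ = solve-∀
        error≤ : error v j ≤ 4 * uncoloured
        error≤ = ≤-trans (+-monoˡ-≤ uncoloured (+-monoˡ-≤ uncoloured (+-mono-≤ own own))) (≤-reflexive (l₃ uncoloured))
          where
          own = strays-own v j cv
          l₃ : ∀ c → c + c + c + c ≡ 4 * c
          l₃ = solve-∀

      -- At a vertex of colour j, `mainTerm` is at most the product of the four other class sizes.
      -- The five sizes add up to at most n, so AM-GM leaves class j no room to be large.
      size-upper : ∀ j → 5 * D * size j ≤ D * n + n
      size-upper j with v , cv ← inhabited j =
        classUpper n T D u u≡625 D₄ 256 (20 * u + 1) D₄+1 upperFact
          (≤-trans (*-monoʳ-≤ 256 mainTerm≤) (AM-GM₄ (size (prev j)) (size (next j)) (size (prev (prev j))) (size (next (next j)))))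
          (sizes-bound j) (mainTerm-lower v j cv)
        where
        mainTerm≤ : mainTerm v j ≤ size (prev j) * (size (next j) * (size (prev (prev j)) * size (next (next j))))
        mainTerm≤ = *-mono-≤ (neighbours≤size v (prev j)) (*-monoˡ-≤ _ (neighbours≤size v (next j)))

      neighbours-upper : ∀ v j → 5 * D * neighbours v j ≤ D * n + n
      neighbours-upper v j = ≤-trans (*-monoʳ-≤ (5 * D) (neighbours≤size v j)) (size-upper j)

      neighbours-lower : ∀ v {i j} → col v ≡ just i → Near i j → E * n ≤ 5 * E * neighbours v j + n
      neighbours-lower v {i} cv (inj₁ refl) =
        neighboursLower n T D u u≡625 E E₁ (20 * u + 1) E₁+1 lowerFact
          (neighbours-upper v (next i)) (size-upper (prev (prev i))) (size-upper (next (next i))) (mainTerm-lower v i cv)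
      neighbours-lower v {i} cv (inj₂ refl) =
        neighboursLower n T D u u≡625 E E₁ (20 * u + 1) E₁+1 lowerFact
          (neighbours-upper v (prev i)) (size-upper (prev (prev i))) (size-upper (next (next i)))
          (subst (λ X → 10 * (T * n ^ 4) ≤ 10 * (u * (T * X)) + (20 * u + 1) * n ^ 4)
            (exchange (neighbours v (prev i)) (neighbours v (next i)) _) (mainTerm-lower v i cv))
        where
        exchange : ∀ x y z → x * (y * z) ≡ y * (x * z)
        exchange = solve-∀

      Small : Fin n → Fin 5 → Set
      Small r k = 5 * E * neighbours r k ≤ 2 * n

      small-near : ∀ r s {i k} → adj G r s ≡ true → col s ≡ just i → Near i k → Small r k
      small-near r s {i} {k} rs cs ik = smallClass n T D u u≡625 E {{D≢0}} E≤D (size-upper k)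
        (neighbours-lower s cs ik) (neighbours-disjoint r s k rs)

      -- If r has a neighbour s in class k, then s sees almost all of classes k ± 1 and
      -- triangle-freeness denies these to r; otherwise r sees nothing of class k.
      small-or-near-small : ∀ r k → Small r k ⊎ (Small r (prev k) × Small r (next k))
      small-or-near-small r k with any? (λ s → (adj G r s ∧ inClass s k) BoolP.≟ true)
      ... | yes (s , eq) with rs , sk ← ∧-true {adj G r s} eq =
              inj₂ (small-near r s rs (hasColour-sound sk) (inj₁ refl) , small-near r s rs (hasColour-sound sk) (inj₂ refl))
      ... | no none′ = inj₁ (≤-trans (≤-reflexive (trans (cong (5 * E *_) neighbours≡0) (ℕP.*-zeroʳ (5 * E)))) z≤n)
        where
        neighbours≡0 : neighbours r k ≡ 0
        neighbours≡0 = ℕP.n≤0⇒n≡0 (≤-trans (∑-mono-≤ λ s → indicator-≤ (adj G r s ∧ inClass s k) λ eq → ⊥-elim (none′ (s , eq)))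
                                           (≤-reflexive (∑-zero {n})))

      -- If class k is not small for r, then k ± 1 are. The same dichotomy at k + 2 shows that k + 2
      -- is small, and j = k - 1 works, or that k + 3 is small, and j = k + 1 works.
      small-rest : ∀ r → ∃ λ j → Small r j × Small r (prev (prev j)) × Small r (next (next j))
      small-rest r with any? (λ k → ¬? (5 * E * neighbours r k ≤? 2 * n))
      -- All five classes are small, so every colour qualifies and 0 is an arbitrary choice.
      ... | no allSmall = 0F , small 0F , small _ , small _
        where
        small : ∀ k → Small r k
        small k with 5 * E * neighbours r k ≤? 2 * n
        ... | yes s = s
        ... | no ¬s = ⊥-elim (allSmall (k , ¬s))
      ... | yes (k , k-large) with small-or-near-small r k
      ...   | inj₁ k-small = ⊥-elim (k-large k-small)
      ...   | inj₂ (prev-small , next-small) with small-or-near-small r (next (next k))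
      ...     | inj₁ nn-small = prev k , prev-small
                  , subst (Small r) (sym (prev-prev-prev k)) nn-small
                  , subst (Small r) (cong next (sym (next-prev k))) next-small
      ...     | inj₂ (_ , nnn-small) = next k , next-small
                  , subst (Small r) (cong prev (sym (prev-next k))) prev-small
                  , nnn-small

      Half : Fin n → Fin 5 → Set
      Half r t = size t < 2 * neighbours r t

      half : ∀ r {j} → Small r j × Small r (prev (prev j)) × Small r (next (next j)) → ∀ t → Near j t → Half r t
      half r {j} (s₀ , s₁ , s₂) t = λ where
          (inj₁ refl) → halfClass n T D u u≡625 E {r = neighbours r (prev j)} halfFact (many r) (walks-bound r j) error≤
            (size-upper (prev j)) (neighbours-upper r (next j)) (size-upper (prev (prev j))) (size-upper (next (next j)))
          (inj₂ refl) → halfClass n T D u u≡625 E {r = neighbours r (next j)} halfFact (many r)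
            (subst (λ X → walks G r ≤ error r j * n ^ 3 + 2 * X) (exchange (neighbours r (prev j)) (neighbours r (next j)) _) (walks-bound r j)) error≤
            (size-upper (next j)) (neighbours-upper r (prev j)) (size-upper (prev (prev j))) (size-upper (next (next j)))
        where
        open ≤-Reasoning
        exchange : ∀ x y z → x * (y * z) ≡ y * (x * z)
        exchange = solve-∀
        a = neighbours r j
        b = neighbours r (prev (prev j))
        c = neighbours r (next (next j))
        l₁ : ∀ e s u → 5 * e * (s + s + u + u) ≡ 2 * (5 * e * s) + 10 * e * u
        l₁ = solve-∀
        l₂ : ∀ e u a b c → 2 * (5 * e * (u + (a + (b + c)))) + 10 * e * u ≡
             20 * e * u + 2 * (5 * e * a + (5 * e * b + 5 * e * c))
        l₂ = solve-∀
        l₃ : ∀ n → n + 2 * (2 * n + (2 * n + 2 * n)) + 3 * n ≡ 16 * n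
        l₃ = solve-∀
        -- After scaling by 5E, the three small classes, counted twice, give 12n, and the uncoloured
        -- vertices give n because 20`E` ≤ `T`; 13n is rounded up to 16n.
        error≤ : 5 * E * error r j ≤ 16 * n
        error≤ = begin
          5 * E * error r j
            ≡⟨ l₁ E (strays r j) uncoloured ⟩
          2 * (5 * E * strays r j) + 10 * E * uncoloured
            ≤⟨ +-monoˡ-≤ (10 * E * uncoloured) (*-monoʳ-≤ 2 (*-monoʳ-≤ (5 * E) (strays-bound r j))) ⟩
          2 * (5 * E * (uncoloured + (a + (b + c)))) + 10 * E * uncoloured
            ≡⟨ l₂ E uncoloured a b c ⟩
          20 * E * uncoloured + 2 * (5 * E * a + (5 * E * b + 5 * E * c))
            ≤⟨ +-mono-≤ (≤-trans (*-monoˡ-≤ uncoloured 20E≤T) few) (*-monoʳ-≤ 2 (+-mono-≤ s₀ (+-mono-≤ s₁ s₂))) ⟩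
          n + 2 * (2 * n + (2 * n + 2 * n))
            ≤⟨ m≤m+n _ (3 * n) ⟩
          n + 2 * (2 * n + (2 * n + 2 * n)) + 3 * n
            ≡⟨ l₃ n ⟩
          16 * n ∎

      -- If adjacent r and s received non-adjacent colours, some class t would be near both colours,
      -- and the disjoint neighbourhoods of r and s would each fill more than half of it.
      colourable : C5Colorable G
      colourable = (λ r → proj₁ (small-rest r)) , λ r s rs → adjacent r s rs (adjacent-or-common _ _)
        where
        adjacent : ∀ r s → adj G r s ≡ true → let i = proj₁ (small-rest r) ; j = proj₁ (small-rest s) in
                   C5adj i j ⊎ (∃ λ t → Near i t × Near j t) → C5adj i j
        adjacent r s rs (inj₁ ij) = ij
        adjacent r s rs (inj₂ (t , it , jt)) = ⊥-elim (<⇒≱ (+-mono-< (half r (proj₂ (small-rest r)) t it) (half s (proj₂ (small-rest s)) t jt)) (begin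
          2 * neighbours r t + 2 * neighbours s t   ≡⟨ ℕP.*-distribˡ-+ 2 (neighbours r t) (neighbours s t) ⟨
          2 * (neighbours r t + neighbours s t)     ≤⟨ *-monoʳ-≤ 2 (neighbours-disjoint r s t rs) ⟩
          2 * size t                                ≡⟨ cong (_+_ (size t)) (+-identityʳ (size t)) ⟩
          size t + size t                           ∎))
          where open ≤-Reasoning

-- The partial colouring read off from a pentagon

module AroundPentagon where
  open Certificate using (⟦_⟧; every-sound)
  open import Data.Nat.Base
  open ℕP using (module ≤-Reasoning; ≤ᵇ⇒≤; *-monoʳ-≤; +-mono-≤; ≤-trans; ≤-reflexive; *-cancelˡ-≤; +-monoʳ-≤; m≤n*m)
  open ∑ℕ
  open NatSums
  open Walks
  open Linear
  open FiveCycle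
  open BoolLemmas
  open Constants
  open PartialColouring
  open NearRegular

  opaque
    atMostTwo : ∀ a b c d e → (a ∧ b ∨ b ∧ c ∨ c ∧ d ∨ d ∧ e ∨ e ∧ a) ∨
                (⟦ a ⟧ + ⟦ b ⟧ + ⟦ c ⟧ + ⟦ d ⟧ + ⟦ e ⟧ ≤ᵇ 2) ≡ true
    atMostTwo = every-sound 5 (λ a b c d e →
      (a ∧ b ∨ b ∧ c ∨ c ∧ d ∨ d ∧ e ∨ e ∧ a) ∨ (⟦ a ⟧ + ⟦ b ⟧ + ⟦ c ⟧ + ⟦ d ⟧ + ⟦ e ⟧ ≤ᵇ 2)) refl

    atMostOne : ∀ a b c d e → (a ∧ b ∨ b ∧ c ∨ c ∧ d ∨ d ∧ e ∨ e ∧ a) ∨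
                (e ∧ b ∨ a ∧ c ∨ b ∧ d ∨ c ∧ e ∨ d ∧ a) ∨
                (⟦ a ⟧ + ⟦ b ⟧ + ⟦ c ⟧ + ⟦ d ⟧ + ⟦ e ⟧ ≤ᵇ 1) ≡ true
    atMostOne = every-sound 5 (λ a b c d e → (a ∧ b ∨ b ∧ c ∨ c ∧ d ∨ d ∧ e ∨ e ∧ a) ∨
      (e ∧ b ∨ a ∧ c ∨ b ∧ d ∨ c ∧ e ∨ d ∧ a) ∨ (⟦ a ⟧ + ⟦ b ⟧ + ⟦ c ⟧ + ⟦ d ⟧ + ⟦ e ⟧ ≤ᵇ 1)) refl

  ≡⇒T : ∀ {b} → b ≡ true → IsTrue b
  ≡⇒T refl = _

  ∨-false : ∀ {a b c d e} → a ≡ false → b ≡ false → c ≡ false → d ≡ false → e ≡ false → a ∨ b ∨ c ∨ d ∨ e ≡ false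
  ∨-false refl refl refl refl refl = refl

  ∨-resolve : ∀ {a b} → a ≡ false → a ∨ b ≡ true → b ≡ true
  ∨-resolve refl eq = eq

  module _ {n} (G : Graph n) (tf : TriangleFree G) (p : Fin 5 → Fin n)
           (edge : ∀ j → adj G (p j) (p (next j)) ≡ true) where

    near-edge : ∀ {i t} → Near i t → adj G (p t) (p i) ≡ true
    near-edge {i} (inj₁ refl) = subst (λ k → adj G (p (prev i)) (p k) ≡ true) (next-prev i) (edge (prev i))
    near-edge {i} (inj₂ refl) = trans (symmetric G _ _) (edge i)

    isClass : Fin 5 → Fin n → Bool
    isClass i x = adj G (p (prev i)) x ∧ adj G (p (next i)) x

    isClass? : ∀ x → Dec (∃ λ i → isClass i x ≡ true)
    isClass? x = any? λ i → isClass i x BoolP.≟ true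

    -- A vertex that sees both neighbours of p i behaves like p i. Two different indices would make
    -- it see two consecutive pentagon vertices, a triangle, so the search order of `any?` is
    -- immaterial.
    colour : Fin n → Maybe (Fin 5)
    colour x with isClass? x
    ... | yes (i , _) = just i
    ... | no  _       = nothing

    colour-sound : ∀ x {i} → colour x ≡ just i → isClass i x ≡ true
    colour-sound x eq with isClass? x
    colour-sound x refl | yes (i , eq) = eq

    colour-near : ∀ x {i t} → colour x ≡ just i → Near i t → adj G (p t) x ≡ true
    colour-near x {i} cx (inj₁ refl) = proj₁ (∧-true {adj G (p (prev i)) x} (colour-sound x cx))
    colour-near x {i} cx (inj₂ refl) = proj₂ (∧-true {adj G (p (prev i)) x} (colour-sound x cx))

    -- Non-adjacent colours have a common neighbour t in C₅, and p t would form a triangle with x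
    -- and y.
    colour-hom : ∀ x y {i k} → adj G x y ≡ true → colour x ≡ just i → colour y ≡ just k → C5adj i k
    colour-hom x y {i} {k} xy cx cy with adjacent-or-common i k
    ... | inj₁ ik = ik
    ... | inj₂ (t , it , kt) = ⊥-elim (tf (p t) x y (colour-near x cx it) xy (colour-near y cy kt))

    p-hom : ∀ i k → adj G (p i) (p k) ≡ true → C5adj i k
    p-hom i k ik with adjacent-or-common i k
    ... | inj₁ c = c
    ... | inj₂ (t , it , kt) = ⊥-elim (tf (p t) (p i) (p k) (near-edge it) ik (near-edge kt))

    colour-p : ∀ j → colour (p j) ≡ just j
    colour-p j with isClass? (p j)
    ... | no ¬class = ⊥-elim (¬class (j , ∧-intro (near-edge (inj₁ refl)) (near-edge (inj₂ refl))))
    ... | yes (k , eq) with kj , k′j ← ∧-true {adj G (p (prev k)) (p j)} eq =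
            cong just (sym (common-neighbour k j (p-hom _ _ kj) (p-hom _ _ k′j)))

    consecutive : ∀ j x → adj G (p j) x ∧ adj G (p (next j)) x ≡ false
    consecutive j x with adj G (p j) x in jx | adj G (p (next j)) x in j′x
    ... | true  | true  = ⊥-elim (tf (p j) (p (next j)) x (edge j) j′x jx)
    ... | true  | false = refl
    ... | false | _     = refl

    touching : Fin n → ℕ
    touching x = ⟦ adj G (p 0F) x ⟧ + ⟦ adj G (p 1F) x ⟧ + ⟦ adj G (p 2F) x ⟧ + ⟦ adj G (p 3F) x ⟧ + ⟦ adj G (p 4F) x ⟧

    -- The pentagon vertices adjacent to x are pairwise non-consecutive, so there are at most two of
    -- them. If there are two, they are p (i - 1) and p (i + 1) for some i, and x is coloured.
    touching-bound : ∀ x → touching x + ⟦ none (colour x) ⟧ ≤ 2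
    touching-bound x with isClass? x
    ... | yes _ = ≤-trans (≤-reflexive (ℕP.+-identityʳ (touching x))) (≤ᵇ⇒≤ (touching x) 2 (≡⇒T
            (∨-resolve noConsecutive (atMostTwo (adj G (p 0F) x) (adj G (p 1F) x) (adj G (p 2F) x) (adj G (p 3F) x) (adj G (p 4F) x)))))
      where
      noConsecutive = ∨-false (consecutive 0F x) (consecutive 1F x) (consecutive 2F x) (consecutive 3F x) (consecutive 4F x)
    ... | no ¬class = ℕP.+-monoˡ-≤ 1 (≤ᵇ⇒≤ (touching x) 1 (≡⇒T
            (∨-resolve noClass (∨-resolve noConsecutive
              (atMostOne (adj G (p 0F) x) (adj G (p 1F) x) (adj G (p 2F) x) (adj G (p 3F) x) (adj G (p 4F) x))))))
      where
      noConsecutive = ∨-false (consecutive 0F x) (consecutive 1F x) (consecutive 2F x) (consecutive 3F x) (consecutive 4F x)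
      notClass : ∀ i → isClass i x ≡ false
      notClass i with isClass i x in eq
      ... | true  = ⊥-elim (¬class (i , eq))
      ... | false = refl
      noClass = ∨-false (notClass 0F) (notClass 1F) (notClass 2F) (notClass 3F) (notClass 4F)

    degrees : ℕ
    degrees = degree G (p 0F) + degree G (p 1F) + degree G (p 2F) + degree G (p 3F) + degree G (p 4F)

    degrees-bound : degrees + uncoloured G tf colour colour-hom ≤ n * 2
    degrees-bound = begin
      degrees + uncoloured G tf colour colour-hom
        ≡⟨ trans (∑-+ _ _) (cong (_+ uncoloured G tf colour colour-hom) (trans (∑-+ _ _) (cong (_+ degree G (p 4F)) (trans (∑-+ _ _)
             (cong (_+ degree G (p 3F)) (trans (∑-+ _ _) (cong (_+ degree G (p 2F)) (∑-+ _ _)))))))) ⟨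
      ∑ (λ x → touching x + ⟦ none (colour x) ⟧)
        ≤⟨ ∑-mono-≤ touching-bound ⟩
      ∑ {n} (λ _ → 2)
        ≡⟨ ∑-const n 2 ⟩
      n * 2 ∎
      where open ≤-Reasoning

    -- The five degrees add up to at least 2n - n/T, whereas an uncoloured vertex contributes at
    -- most one instead of two; the deficit from 2n bounds their number.
    few-uncoloured : ∀ T → (∀ j → 2 * T * n ≤ 5 * T * degree G (p j) + n) → T * uncoloured G tf colour colour-hom ≤ n
    few-uncoloured T large = *-cancelˡ-≤ 5 (combine
      (+-mono-≤ (+-mono-≤ (large 0F) (+-mono-≤ (large 1F) (+-mono-≤ (large 2F) (+-mono-≤ (large 3F) (large 4F)))))
                (*-monoʳ-≤ (5 * T) degrees-bound))
      (identity T n _ _ _ _ _ _))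
      where
      identity : ∀ t n a b c d e z →
        5 * (t * z) + ((5 * t * a + n + (5 * t * b + n + (5 * t * c + n + (5 * t * d + n + (5 * t * e + n))))) + 5 * t * (n * 2))
        ≡ 5 * n + ((2 * t * n + (2 * t * n + (2 * t * n + (2 * t * n + 2 * t * n)))) + 5 * t * (a + b + c + d + e + z))
      identity = solve-∀

  module _ {n} .{{_ : NonZero n}} (S : Scales) (G : Graph n) (tf : TriangleFree G) where
    open Scales S
    private
      instance
        T-nonZero : NonZero T
        T-nonZero = T≢0

    module _ (many : ∀ v → 10 * (Q * n ^ 4) ≤ 5 * (u * (Q * walks G v)) + n ^ 4) where
      -- Division by 1000`T`: finding the pentagon takes precision 1/`Q`, while the colouring
      -- argument works at precision 1/`T`, that of the share of uncoloured vertices.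
      many′ : ∀ v → 10 * (T * n ^ 4) ≤ 5 * u * (T * walks G v) + n ^ 4
      many′ v = *-cancelˡ-≤ (T * 1000) {{ℕP.m*n≢0 T 1000}} (begin
        T * 1000 * (10 * (T * n ^ 4))
          ≡⟨ l₁ T 1000 (n ^ 4) ⟩
        10 * (T * T * 1000 * n ^ 4)
          ≡⟨ cong (λ q → 10 * (q * n ^ 4)) Q≡1000T² ⟨
        10 * (Q * n ^ 4)
          ≤⟨ many v ⟩
        5 * (u * (Q * walks G v)) + n ^ 4
          ≤⟨ +-monoʳ-≤ (5 * (u * (Q * walks G v))) (m≤n*m (n ^ 4) (T * 1000) {{ℕP.m*n≢0 T 1000}}) ⟩
        5 * (u * (Q * walks G v)) + T * 1000 * n ^ 4
          ≡⟨ cong (λ q → 5 * (u * (q * walks G v)) + T * 1000 * n ^ 4) Q≡1000T² ⟩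
        5 * (u * (T * T * 1000 * walks G v)) + T * 1000 * n ^ 4
          ≡⟨ l₂ u T 1000 (walks G v) (n ^ 4) ⟩
        T * 1000 * (5 * u * (T * walks G v) + n ^ 4) ∎)
        where
        open ≤-Reasoning
        l₁ : ∀ t k m → t * k * (10 * (t * m)) ≡ 10 * (t * t * k * m)
        l₁ = solve-∀
        l₂ : ∀ u t k w m → 5 * (u * (t * t * k * w)) + t * k * m ≡ t * k * (5 * u * (t * w) + m)
        l₂ = solve-∀

      nearRegular⇒colourable : ∀ a b c d e → isWalk G a b c d e ≡ true →
        T * T * cycleDeviation G tf a b c d e < n * n → C5Colorable G
      nearRegular⇒colourable a b c d e walk lt =
        colourable G tf (colour G tf p edge) (colour-hom G tf p edge) S many′
          (few-uncoloured G tf p edge T large) (λ j → p j , colour-p G tf p edge j)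
        where
        after-ab = ∧-true {adj G a b} walk
        after-bc = ∧-true {adj G b c} (proj₂ after-ab)
        after-cd = ∧-true {adj G c d} (proj₂ after-bc)
        after-de = ∧-true {adj G d e} (proj₂ after-cd)
        p : Fin 5 → Fin n
        p 0F = a
        p 1F = b
        p 2F = c
        p 3F = d
        p 4F = e
        edge : ∀ j → adj G (p j) (p (next j)) ≡ true
        edge 0F = proj₁ after-ab
        edge 1F = proj₁ after-bc
        edge 2F = proj₁ after-cd
        edge 3F = proj₁ after-de
        edge 4F = proj₂ after-de
        α = deviation G tf a
        β = deviation G tf b
        γ = deviation G tf c
        δ = deviation G tf d
        ε = deviation G tf e
        lower : ∀ v {rest} → deviation G tf v + rest ≡ α + β + γ + δ + ε → 2 * T * n ≤ 5 * T * degree G v + n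
        lower v eq = degree-lower G tf T Q u Q≡1000T² u≡625 many v (subst (λ x → T * T * x < n * n) (sym eq) lt)
        large : ∀ j → 2 * T * n ≤ 5 * T * degree G (p j) + n
        large 0F = lower a (l α β γ δ ε)
          where
          l : ∀ a b c d e → a + (b + c + d + e) ≡ a + b + c + d + e
          l = solve-∀
        large 1F = lower b (l α β γ δ ε)
          where
          l : ∀ a b c d e → b + (a + c + d + e) ≡ a + b + c + d + e
          l = solve-∀
        large 2F = lower c (l α β γ δ ε)
          where
          l : ∀ a b c d e → c + (a + b + d + e) ≡ a + b + c + d + e
          l = solve-∀
        large 3F = lower d (l α β γ δ ε)
          where
          l : ∀ a b c d e → d + (a + b + c + e) ≡ a + b + c + d + e
          l = solve-∀
        large 4F = lower e (l α β γ δ ε)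
          where
          l : ∀ a b c d e → e + (a + b + c + d) ≡ a + b + c + d + e
          l = solve-∀

      manyWalks⇒colourable : C5Colorable G
      manyWalks⇒colourable =
        let a , b , c , d , e , walk , lt = nearRegularPentagon G tf T Q u Q≡1000T² u≡625 many
        in nearRegular⇒colourable a b c d e walk lt

-- The C₅-degree as a sum over closed walks

module Counting where
  open Certificate using (⟦_⟧)
  open import Data.Nat.Base
  open ℕP using (module ≤-Reasoning; +-identityʳ)
  open ∑ℕ
  open NatSums
  open Walks
  open BoolLemmas

  count : ∀ {A : Set} → (A → Bool) → List A → ℕ
  count f xs = length (filter (λ x → f x BoolP.≟ true) xs)

  count-∷ : ∀ {A : Set} (f : A → Bool) x xs → count f (x ∷ xs) ≡ ⟦ f x ⟧ + count f xs
  count-∷ f x xs with f x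
  ... | true  = refl
  ... | false = refl

  count-++ : ∀ {A : Set} (f : A → Bool) xs ys → count f (xs ++ ys) ≡ count f xs + count f ys
  count-++ f xs ys = trans (cong length (filter-++ (λ x → f x BoolP.≟ true) xs ys)) (length-++ (filter (λ x → f x BoolP.≟ true) xs))

  count-map : ∀ {A B : Set} {n} (f : A → Bool) (g : B → A) (h : Fin n → B) →
    count f (map g (tabulate h)) ≡ ∑ λ i → ⟦ f (g (h i)) ⟧
  count-map {n = zero}  f g h = sym (∑-empty _)
  count-map {n = suc n} f g h =
    trans (count-∷ f (g (h zero)) _) (trans (cong (_+_ ⟦ f (g (h zero)) ⟧) (count-map f g (h ∘ suc))) (sym (∑-suc _)))

  count-concatMap : ∀ {A B : Set} {n} (f : A → Bool) (g : B → List A) (h : Fin n → B) →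
    count f (concatMap g (tabulate h)) ≡ ∑ λ i → count f (g (h i))
  count-concatMap {n = zero}  f g h = sym (∑-empty _)
  count-concatMap {n = suc n} f g h =
    trans (count-++ f (g (h zero)) _) (trans (cong (_+_ (count f (g (h zero)))) (count-concatMap f g (h ∘ suc))) (sym (∑-suc _)))

  count-allTuples5 : ∀ n (f : Tuple5 n → Bool) →
    count f (allTuples5 n) ≡ ∑₅ λ a b c d e → ⟦ f (a , b , c , d , e) ⟧
  count-allTuples5 n f =
    trans (count-concatMap f _ _) (∑-cong λ a →
    trans (count-concatMap f _ _) (∑-cong λ b →
    trans (count-concatMap f _ _) (∑-cong λ c →
    trans (count-concatMap f _ _) (∑-cong λ d →
      count-map f _ _))))

  ∑-delta : ∀ {n} (v : Fin n) (F : Fin n → ℕ) → ∑ (λ a → ⟦ eqb v a ⟧ * F a) ≡ F v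
  ∑-delta {suc n} zero F = begin
    ∑ (λ a → ⟦ eqb zero a ⟧ * F a)      ≡⟨ ∑-suc _ ⟩
    F zero + 0 + ∑ {n} (λ _ → 0)        ≡⟨ cong₂ _+_ (+-identityʳ (F zero)) (∑-zero {n}) ⟩
    F zero + 0                          ≡⟨ +-identityʳ (F zero) ⟩
    F zero                              ∎
    where open ≡-Reasoning
  ∑-delta {suc n} (suc v) F = begin
    ∑ (λ a → ⟦ eqb (suc v) a ⟧ * F a)               ≡⟨ ∑-suc _ ⟩
    ∑ (λ a → ⟦ eqb (suc v) (suc a) ⟧ * F (suc a))   ≡⟨ ∑-cong (λ a → cong (λ b → ⟦ b ⟧ * F (suc a)) (eqb-suc a)) ⟩
    ∑ (λ a → ⟦ eqb v a ⟧ * F (suc a))               ≡⟨ ∑-delta v (F ∘ suc) ⟩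
    F (suc v)                                       ∎
    where
    open ≡-Reasoning
    eqb-suc : ∀ a → eqb (suc v) (suc a) ≡ eqb v a
    eqb-suc a with v ≟ a
    ... | yes _ = refl
    ... | no  _ = refl

  module _ {n} (G : Graph n) (v : Fin n) where
    private
      W : Fin n → Fin n → Fin n → Fin n → Fin n → ℕ
      W a b c d e = ⟦ isWalk G a b c d e ⟧

    -- Injectivity is dropped, and the requirement that v lie on the image becomes a union bound
    -- over the five positions.
    through-≤ : ∀ a b c d e → ⟦ isInjHomC5Through G v (a , b , c , d , e) ⟧ ≤
      W a b c d e * ⟦ eqb v a ⟧ + W a b c d e * ⟦ eqb v b ⟧ + W a b c d e * ⟦ eqb v c ⟧
        + W a b c d e * ⟦ eqb v d ⟧ + W a b c d e * ⟦ eqb v e ⟧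
    through-≤ a b c d e with isWalk G a b c d e
    ... | false = z≤n
    ... | true  = bound _ (eqb v a) (eqb v b) (eqb v c) (eqb v d) (eqb v e)
      where
      bound : ∀ i p q r s t → ⟦ i ∧ (p ∨ q ∨ r ∨ s ∨ t) ⟧ ≤ 1 * ⟦ p ⟧ + 1 * ⟦ q ⟧ + 1 * ⟦ r ⟧ + 1 * ⟦ s ⟧ + 1 * ⟦ t ⟧
      bound false p     q     r     s     t     = z≤n
      bound true  true  q     r     s     t     = s≤s z≤n
      bound true  false true  r     s     t     = s≤s z≤n
      bound true  false false true  s     t     = s≤s z≤n
      bound true  false false false true  t     = s≤s z≤n
      bound true  false false false false true  = s≤s z≤n
      bound true  false false false false false = z≤n

    C5deg≤5*walks : C5deg G v ≤ 5 * walks G v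
    C5deg≤5*walks = begin
      C5deg G v
        ≡⟨ count-allTuples5 n (isInjHomC5Through G v) ⟩
      ∑₅ (λ a b c d e → ⟦ isInjHomC5Through G v (a , b , c , d , e) ⟧)
        ≤⟨ ∑₅-mono-≤ through-≤ ⟩
      ∑₅ (λ a b c d e → W a b c d e * ⟦ eqb v a ⟧ + W a b c d e * ⟦ eqb v b ⟧ + W a b c d e * ⟦ eqb v c ⟧
        + W a b c d e * ⟦ eqb v d ⟧ + W a b c d e * ⟦ eqb v e ⟧)
        ≡⟨ trans (∑₅-+ _ _) (cong (_+ E) (trans (∑₅-+ _ _) (cong (_+ D) (trans (∑₅-+ _ _) (cong (_+ C) (∑₅-+ _ _)))))) ⟩
      A + B + C + D + E
        ≡⟨ cong₂ _+_ (cong₂ _+_ (cong₂ _+_ (cong₂ _+_ A≡ B≡) C≡) D≡) E≡ ⟩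
      walks G v + walks G v + walks G v + walks G v + walks G v
        ≡⟨ five (walks G v) ⟩
      5 * walks G v ∎
      where
      open ≤-Reasoning
      A = ∑₅ λ a b c d e → W a b c d e * ⟦ eqb v a ⟧
      B = ∑₅ λ a b c d e → W a b c d e * ⟦ eqb v b ⟧
      C = ∑₅ λ a b c d e → W a b c d e * ⟦ eqb v c ⟧
      D = ∑₅ λ a b c d e → W a b c d e * ⟦ eqb v d ⟧
      E = ∑₅ λ a b c d e → W a b c d e * ⟦ eqb v e ⟧
      A≡ : A ≡ walks G v
      A≡ = trans (∑-cong λ a →
             trans (∑-cong λ b → trans (∑-cong λ c → trans (∑-cong λ d → ∑-*ʳ ⟦ eqb v a ⟧ _)
               (∑-*ʳ ⟦ eqb v a ⟧ _)) (∑-*ʳ ⟦ eqb v a ⟧ _))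
             (trans (∑-*ʳ ⟦ eqb v a ⟧ _) (ℕP.*-comm (walks G a) ⟦ eqb v a ⟧)))
           (∑-delta v (walks G))
      B≡ : B ≡ walks G v
      B≡ = trans (sym (∑₅-walks-rotate G λ a b c d e → ⟦ eqb v b ⟧)) C≡′
        where
        C≡′ : ∑₅ (λ a b c d e → W a b c d e * ⟦ eqb v c ⟧) ≡ walks G v
        C≡′ = trans (sym (∑₅-walks-rotate G λ a b c d e → ⟦ eqb v c ⟧)) (trans (sym (∑₅-walks-rotate G λ a b c d e → ⟦ eqb v d ⟧))
                (trans (sym (∑₅-walks-rotate G λ a b c d e → ⟦ eqb v e ⟧)) A≡))
      C≡ : C ≡ walks G v
      C≡ = trans (∑₅-walks-rotate G λ a b c d e → ⟦ eqb v b ⟧) B≡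
      D≡ : D ≡ walks G v
      D≡ = trans (∑₅-walks-rotate G λ a b c d e → ⟦ eqb v c ⟧) C≡
      E≡ : E ≡ walks G v
      E≡ = trans (∑₅-walks-rotate G λ a b c d e → ⟦ eqb v d ⟧) D≡
      five : ∀ w → w + w + w + w + w ≡ 5 * w
      five = solve-∀

-- Clearing denominators in the degree condition

module Rational where
  open import Data.Rational.Base using (ℚ; _/_; _≤_; _<_; _*_; -_; _-_; 0ℚ; toℚᵘ)
  import Data.Rational.Properties as ℚP
  open import Data.Rational.Unnormalised.Base as ℚᵘ using (mkℚᵘ)
  import Data.Rational.Unnormalised.Properties as ℚᵘP

  module _ (q : ℕ) where
    reciprocal : ℚ
    reciprocal = + 1 / suc q

    0<reciprocal : 0ℚ < reciprocal
    0<reciprocal = ℚP.positive⁻¹ reciprocal {{ℚP.normalize-pos 1 (suc q)}}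

    -- The hypothesis times 625 · `suc q`, with the negative term moved across so that everything
    -- lives in ℕ. Unnormalised fractions are used because their numerators and denominators compute
    -- without common divisors being removed.
    clear-denominators : ∀ m k → (ℕ→ℚ 10 - reciprocal) * (+ m / 625) ≤ ℕ→ℚ k →
      10 Nat.* (suc q Nat.* m) Nat.≤ 625 Nat.* (suc q Nat.* k) Nat.+ m
    clear-denominators m k h = ℤP.drop‿+≤+ (begin
      + (10 Nat.* (suc q Nat.* m))
        ≡⟨ pos-product 10 (suc q) m ⟩
      + 10 Int.* (+ suc q Int.* + m)
        ≡⟨ numerator (+ suc q) (+ m) ⟩
      (+ 10 Int.* + suc q Int.+ Int.- + 1 Int.* + 1) Int.* + m Int.* + 1 Int.+ + m
        ≤⟨ ℤP.+-monoˡ-≤ (+ m) (ℚᵘP.drop-*≤* unnormalised) ⟩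
      + k Int.* + (suc (q Nat.+ 0) Nat.* 625) Int.+ + m
        ≡⟨ cong (Int._+ + m) denominator ⟩
      + (625 Nat.* (suc q Nat.* k)) Int.+ + m ∎)
      where
      open ℤP.≤-Reasoning
      pos-product : ∀ a b c → + (a Nat.* (b Nat.* c)) ≡ + a Int.* (+ b Int.* + c)
      pos-product a b c = trans (ℤP.pos-* a (b Nat.* c)) (cong (+ a Int.*_) (ℤP.pos-* b c))
      numerator : ∀ s m → + 10 Int.* (s Int.* m) ≡ (+ 10 Int.* s Int.+ Int.- + 1 Int.* + 1) Int.* m Int.* + 1 Int.+ m
      numerator = ℤSolver.solve-∀
      denominator : + k Int.* + (suc (q Nat.+ 0) Nat.* 625) ≡ + (625 Nat.* (suc q Nat.* k))
      denominator = trans (cong (λ d → + k Int.* + (suc d Nat.* 625)) (ℕP.+-identityʳ q))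
                   (trans (sym (ℤP.pos-* k (suc q Nat.* 625))) (cong +_ (rotate k (suc q) 625)))
        where
        rotate : ∀ x y z → x Nat.* (y Nat.* z) ≡ z Nat.* (y Nat.* x)
        rotate = solve-∀
      unnormalised : (mkℚᵘ (+ 10) 0 ℚᵘ.- mkℚᵘ (+ 1) q) ℚᵘ.* mkℚᵘ (+ m) 624 ℚᵘ.≤ mkℚᵘ (+ k) 0
      unnormalised = ℚᵘP.≤-respˡ-≃ lhs (ℚᵘP.≤-respʳ-≃ (ℚP.toℚᵘ-fromℚᵘ (mkℚᵘ (+ k) 0)) (ℚP.toℚᵘ-mono-≤ h))
        where
        lhs : toℚᵘ ((ℕ→ℚ 10 - reciprocal) * (+ m / 625)) ℚᵘ.≃ (mkℚᵘ (+ 10) 0 ℚᵘ.- mkℚᵘ (+ 1) q) ℚᵘ.* mkℚᵘ (+ m) 624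
        lhs = ℚᵘP.≃-trans (ℚP.toℚᵘ-homo-* (ℕ→ℚ 10 - reciprocal) (+ m / 625)) (ℚᵘP.*-cong
          (ℚᵘP.≃-trans (ℚP.toℚᵘ-homo-+ (ℕ→ℚ 10) (- reciprocal)) (ℚᵘP.+-cong (ℚP.toℚᵘ-fromℚᵘ (mkℚᵘ (+ 10) 0))
            (ℚᵘP.≃-trans (ℚP.toℚᵘ-homo‿- reciprocal) (ℚᵘP.-‿cong (ℚP.toℚᵘ-fromℚᵘ (mkℚᵘ (+ 1) q))))))
          (ℚP.toℚᵘ-fromℚᵘ (mkℚᵘ (+ m) 624)))

-- Assembly

module Main where
  open import Data.Nat.Base
  open ℕP using (module ≤-Reasoning; *-monoʳ-≤; +-monoˡ-≤; m*n≢0; suc-pred)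
  open Constants
  open Scales scales
  open Counting
  open Walks
  open AroundPentagon
  open Rational

  private instance
    T-nonZero : NonZero T
    T-nonZero = T≢0
    θ-nonZero : NonZero (T * T)
    θ-nonZero = m*n≢0 T T
    Q-nonZero : NonZero Q
    Q-nonZero = subst NonZero (sym Q≡1000T²) (m*n≢0 (T * T) 1000)

  -- Lets 1/`Q` be written with the visibly nonzero denominator `suc q`.
  q : ℕ
  q = pred Q

  manyWalks : ∀ {n} (G : Graph n) v →
    10 * (suc q * n ^ 4) ≤ 625 * (suc q * C5deg G v) + n ^ 4 →
    10 * (Q * n ^ 4) ≤ 5 * (u * (Q * walks G v)) + n ^ 4
  manyWalks {n} G v h = begin
    10 * (Q * n ^ 4)                       ≡⟨ cong (λ k → 10 * (k * n ^ 4)) (suc-pred Q) ⟨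
    10 * (suc q * n ^ 4)                   ≤⟨ h ⟩
    625 * (suc q * C5deg G v) + n ^ 4      ≡⟨ cong₂ (λ c k → c * (k * C5deg G v) + n ^ 4) (sym u≡625) (suc-pred Q) ⟩
    u * (Q * C5deg G v) + n ^ 4            ≤⟨ +-monoˡ-≤ (n ^ 4) (*-monoʳ-≤ u (*-monoʳ-≤ Q (C5deg≤5*walks G v))) ⟩
    u * (Q * (5 * walks G v)) + n ^ 4      ≡⟨ cong (_+ n ^ 4) (regroup u Q (walks G v)) ⟩
    5 * (u * (Q * walks G v)) + n ^ 4      ∎
    where
    open ≤-Reasoning
    regroup : ∀ u q w → u * (q * (5 * w)) ≡ 5 * (u * (q * w))
    regroup = solve-∀

  colouring : ∀ n → n ≥ 1 → (G : Graph n) → TriangleFree G →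
    (∀ v → 10 * (suc q * n ^ 4) ≤ 625 * (suc q * C5deg G v) + n ^ 4) → C5Colorable G
  colouring (suc n) _ G tf h = manyWalks⇒colourable scales G tf λ v → manyWalks G v (h v)

open import Data.Rational using (ℚ; 0ℚ; _<_; _≤_; _*_; _-_; _/_)
open Rational
open Main

theorem2p3 : Σ ℚ λ ε → 0ℚ < ε × Σ ℕ λ N₀ → ∀ (n : ℕ) → n ≥ N₀ →
    (G : Graph n) → TriangleFree G →
    (∀ (v : Fin n) → (ℕ→ℚ 10 - ε) * ((+ (n ^ 4)) / 625) ≤ ℕ→ℚ (C5deg G v)) →
    C5Colorable G
-- N₀ = 1: a positive n is all that the cancellation of powers of n asks for.
theorem2p3 = reciprocal q , 0<reciprocal q , 1 , λ n n≥1 G tf h →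
  colouring n n≥1 G tf λ v → clear-denominators q (n ^ 4) (C5deg G v) (h v)
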